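{- Let $G=H+3=K+L+3$ be a simple loony endgame, where $3$ denotes a 3-chain, $H=K+L$ is non-empty and composed entirely of disjoint loops (of even length at least 4), and $L$ is a loop of smallest length in $H$. Then the following move in $G$ is optimal: - if $v(H)=2$, open the 3-chain; - if $v(H)\ne2$, $L$ is a 6-loop and $v(K)=2$, open the 3-chain; - in all other cases, open $L$.
   Context: Game. A dots and boxes game (position) $G$ consists of a finite set of unclaimed boxes and a finite set of undrawn lines, each undrawn line bordering either exactly one box or exactly two distinct boxes, each box being bordered by at least one and at most four undrawn lines. Two players play. The player to move draws (removes) an undrawn line; every box none of whose bordering lines is still undrawn is then claimed by that player. If the move claims at least one box the same player must move again (if a line remains); otherwise the other player moves. Claiming a box when possible is not compulsory. The game ends when no line remains. Each player maximises (own boxes) minus (opponent's boxes), counting only boxes claimed from $G$ onwards. Value. $v(G)$ is the net score, under optimal play, of the player who is NOT to move in $G$. Equivalently, $v(G)=0$ if $G$ has no undrawn lines, and otherwise $v(G)=\min_m v(G;m)$ over undrawn lines $m$, where, if drawing $m$ claims $k$ boxes and leaves the position $G_m$, then $v(G;m)=v(G_m)-k$ if $k\ge1$ and $v(G;m)=-v(G_m)$ if $k=0$. A move $m$ is optimal if $v(G;m)=v(G)$. Chains and loops. $G+H$ is the disjoint union. An $n$-chain (denoted $n$) has boxes $b_1,\dots,b_n$ and lines $e_0,\dots,e_n$, where $e_i$ borders $b_i,b_{i+1}$ for $1\le i\le n-1$, $e_0$ borders only $b_1$ and $e_n$ borders only $b_n$. An $n$-loop ($n\ge4$, denoted $n_\ell$)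 has boxes $b_1,\dots,b_n$ and lines $e_1,\dots,e_n$, $e_i$ bordering $b_i,b_{i+1}$ (indices mod $n$). A simple loony endgame is a finite (possibly empty) disjoint union of chains of length at least 3 and loops of even length at least 4. Opening a component $Z$ of it means drawing a line of $Z$; $v(G;Z)$ denotes $v(G;m)$ for any line $m$ of $Z$ (it does not depend on the line). -}

module Defs where

open import Data.Bool.Base using (true; false)
open import Data.Fin.Base using (Fin; zero; suc; inject₁; fromℕ; _↑ˡ_; _↑ʳ_; splitAt)
open import Data.Fin.Properties using (_≟_; suc-injective; inject₁-injective; ↑ˡ-injective; ↑ʳ-injective; splitAt⁻¹-↑ˡ; splitAt⁻¹-↑ʳ)
open import Data.Integer.Base as ℤ using (ℤ; +_; 0ℤ; _⊓_)
open import Data.List.Base as List using (List; []; _∷_)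
open import Data.List.Membership.DecPropositional using (_∈?_)
open import Data.List.Membership.Propositional using (_∈_)
open import Data.List.Membership.Propositional.Properties using (∈-map⁺; ∈-map⁻)
open import Data.List.Relation.Unary.Any using (here; there)
open import Data.Nat.Base using (ℕ; zero; suc; _+_; _≤_; z≤n; s≤s; NonZero)
open import Data.Nat.Divisibility.Core using (_∣_)
open import Data.Nat.Properties using (≤-trans; n≤1+n; +-suc; +-monoʳ-≤; ≤-reflexive; +-mono-≤; m≤n⇒m≤1+n; +-identityʳ)
open import Data.Product.Base using (_×_; _,_)
open import Data.Sum.Base as Sum using (_⊎_; inj₁; inj₂)
open import Data.Vec.Base as Vec using (Vec; []; _∷_; _∷ʳ_; _++_; lookup; tabulate; removeAt; allFin; count; foldr₁)
open import Data.Vec.Relation.Unary.Any using (Any; any?; here; there)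
open import Data.Vec.Relation.Unary.Any.Properties as Any using ()
open import Function.Base using (_∘_)
open import Level using (0ℓ)
open import Relation.Binary.PropositionalEquality
open import Relation.Nullary using (¬_; yes; no; does; contradiction; _×-dec_; ¬?)
open import Relation.Unary using (Pred; Decidable)

data Line (b : ℕ) : Set where
  edge    : (x : Fin b) → Line b
  between : (x y : Fin b) → .(x ≢ y) → Line b

boxes : ∀ {b} → Line b → List (Fin b)
boxes (edge x)        = x ∷ []
boxes (between x y _) = x ∷ y ∷ []

_Borders_ : ∀ {b} → Line b → Fin b → Set
e Borders x = x ∈ boxes e

borders? : ∀ {b} (x : Fin b) → Decidable (_Borders x)
borders? x e = _∈?_ _≟_ x (boxes e)

-- The undrawn lines of a position.  Two lines may border the same boxes, so
-- lines are identified by their index.  The unclaimed boxes are those bordered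
-- by some line of the vector; boxes keep their names after others are claimed.
Position : ℕ → ℕ → Set
Position b l = Vec (Line b) l

Unclaimed : ∀ {b l} → Position b l → Fin b → Set
Unclaimed P x = Any (_Borders x) P

unclaimed? : ∀ {b l} (P : Position b l) → Decidable (Unclaimed P)
unclaimed? P x = any? (borders? x) P

degree : ∀ {b l} → Position b l → Fin b → ℕ
degree P x = count (borders? x) P

claims : ∀ {b l} → Position b (suc l) → Fin (suc l) → ℕ
claims {b} P m =
  count (λ x → borders? x (lookup P m) ×-dec ¬? (unclaimed? (removeAt P m) x)) (allFin b)

-- The net score of the player not to move before a move claiming k boxes,
-- where w is the value of the resulting position.
afterClaiming : ℕ → ℤ → ℤ
afterClaiming zero      w = ℤ.- w
afterClaiming k@(suc _) w = w ℤ.- + k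

value     : ∀ {b l} → Position b l → ℤ
moveValue : ∀ {b l} → Position b l → Fin l → ℤ

value {l = zero}  _ = 0ℤ
value {l = suc _} P = foldr₁ _⊓_ (tabulate (moveValue P))

moveValue {l = suc _} P m = afterClaiming (claims P m) (value (removeAt P m))

record Game : Set where
  field
    {#boxes #lines} : ℕ
    lines           : Position #boxes #lines
    degree-bounds   : ∀ x → 1 ≤ degree lines x × degree lines x ≤ 4

open Game public

Move : Game → Set
Move G = Fin (#lines G)

v : Game → ℤ
v G = value (lines G)

v[_⨾_] : (G : Game) → Move G → ℤ
v[ G ⨾ m ] = moveValue (lines G) m

Optimal : (G : Game) → Move G → Set
Optimal G m = v[ G ⨾ m ] ≡ v G

module _ {A : Set} {P : Pred A 0ℓ} (P? : Decidable P) where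

  count-++ : ∀ {m n} (xs : Vec A m) (ys : Vec A n) →
             count P? (xs ++ ys) ≡ count P? xs + count P? ys
  count-++ []       ys = refl
  count-++ (x ∷ xs) ys with does (P? x)
  ... | true  = cong suc (count-++ xs ys)
  ... | false = count-++ xs ys

  count-∷-≤ : ∀ {n k} x (xs : Vec A n) → count P? xs ≤ k → count P? (x ∷ xs) ≤ suc k
  count-∷-≤ x xs c≤k with does (P? x)
  ... | true  = s≤s c≤k
  ... | false = m≤n⇒m≤1+n c≤k

  count-∷ʳ-≤ : ∀ {n k} (xs : Vec A n) x → count P? xs ≤ k → count P? (xs ∷ʳ x) ≤ suc k
  count-∷ʳ-≤ {k = k} [] x c≤k with does (P? x)
  ... | true  = s≤s z≤n
  ... | false = z≤n
  count-∷ʳ-≤ (y ∷ xs) x c≤k with does (P? y)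
  count-∷ʳ-≤ {k = suc k} (y ∷ xs) x (s≤s c≤k) | true = s≤s (count-∷ʳ-≤ xs x c≤k)
  ... | false = count-∷ʳ-≤ xs x c≤k

  count-none : ∀ {n} (xs : Vec A n) → ¬ Any P xs → count P? xs ≡ 0
  count-none []       _    = refl
  count-none (x ∷ xs) none with P? x
  ... | yes p = contradiction (here p) none
  ... | no  _ = count-none xs (none ∘ there)

  count-any : ∀ {n} {xs : Vec A n} → Any P xs → 1 ≤ count P? xs
  count-any {xs = x ∷ xs} p with P? x
  count-any               p         | yes _ = s≤s z≤n
  count-any               (here q)  | no ¬q = contradiction q ¬q
  count-any               (there p) | no _  = count-any p

  count-tabulate-≤1 : ∀ {n} (f : Fin n → A) → (∀ i j → P (f i) → P (f j) → i ≡ j) →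
                      count P? (tabulate f) ≤ 1
  count-tabulate-≤1 {zero}  f _      = z≤n
  count-tabulate-≤1 {suc n} f unique with P? (f zero)
  ... | yes p = s≤s (≤-reflexive (count-none (tabulate (f ∘ suc)) none))
    where
    none : ¬ Any P (tabulate (f ∘ suc))
    none q with Any.tabulate⁻ q
    ... | i , r with () ← unique zero (suc i) p r
  ... | no _  = count-tabulate-≤1 (f ∘ suc)
                  (λ i j p q → suc-injective (unique (suc i) (suc j) p q))

count-∪ : ∀ {A B : Set} {P Q : Pred A 0ℓ} {R : Pred B 0ℓ}
          (P? : Decidable P) (Q? : Decidable Q) (R? : Decidable R) (f : A → B) →
          (∀ x → R (f x) → P x ⊎ Q x) → ∀ {n} (e : Fin n → A) →
          count R? (tabulate (f ∘ e)) ≤ count P? (tabulate e) + count Q? (tabulate e)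
count-∪ P? Q? R? f R⇒ {zero}  e = z≤n
count-∪ P? Q? R? f R⇒ {suc n} e
  with R? (f (e zero)) | P? (e zero) | Q? (e zero) | count-∪ P? Q? R? f R⇒ (e ∘ suc)
... | yes _ | yes _ | yes _ | ih = s≤s (≤-trans ih (+-monoʳ-≤ _ (n≤1+n _)))
... | yes _ | yes _ | no  _ | ih = s≤s ih
... | yes _ | no  _ | yes _ | ih = ≤-trans (s≤s ih) (≤-reflexive (sym (+-suc _ _)))
... | yes r | no ¬p | no ¬q | _  = contradiction (R⇒ (e zero) r) Sum.[ ¬p , ¬q ]
... | no  _ | yes _ | yes _ | ih = m≤n⇒m≤1+n (≤-trans ih (+-monoʳ-≤ _ (n≤1+n _)))
... | no  _ | yes _ | no  _ | ih = m≤n⇒m≤1+n ih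
... | no  _ | no  _ | yes _ | ih = ≤-trans ih (+-monoʳ-≤ _ (n≤1+n _))
... | no  _ | no  _ | no  _ | ih = ih

count-map : ∀ {A B : Set} {P : Pred A 0ℓ} {Q : Pred B 0ℓ}
            (P? : Decidable P) (Q? : Decidable Q) (f : A → B) →
            (∀ {x} → P x → Q (f x)) → (∀ {x} → Q (f x) → P x) →
            ∀ {n} (xs : Vec A n) → count Q? (Vec.map f xs) ≡ count P? xs
count-map P? Q? f P⇒Q Q⇒P []       = refl
count-map P? Q? f P⇒Q Q⇒P (x ∷ xs) with P? x | Q? (f x)
... | yes _ | yes _ = cong suc (count-map P? Q? f P⇒Q Q⇒P xs)
... | no  _ | no  _ = count-map P? Q? f P⇒Q Q⇒P xs
... | yes p | no ¬q = contradiction (P⇒Q p) ¬q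
... | no ¬p | yes q = contradiction (Q⇒P q) ¬p

module _ {b c} (f : Fin b → Fin c) (inj : ∀ i j → f i ≡ f j → i ≡ j) where

  relabel : Line b → Line c
  relabel (edge x)          = edge (f x)
  relabel (between x y x≢y) = between (f x) (f y) (λ eq → x≢y (inj x y eq))

  boxes-relabel : ∀ e → boxes (relabel e) ≡ List.map f (boxes e)
  boxes-relabel (edge _)        = refl
  boxes-relabel (between _ _ _) = refl

  relabel-borders⁺ : ∀ {x e} → e Borders x → relabel e Borders f x
  relabel-borders⁺ {e = e} p = subst (_ ∈_) (sym (boxes-relabel e)) (∈-map⁺ f p)

  relabel-borders⁻ : ∀ {x e} → relabel e Borders f x → e Borders x
  relabel-borders⁻ {x} {e} p with ∈-map⁻ f (subst (_ ∈_) (boxes-relabel e) p)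
  ... | y , y∈ , eq = subst (_∈ boxes e) (sym (inj x y eq)) y∈

  relabel-avoids : ∀ {y} → (∀ x → y ≢ f x) → ∀ {l} (P : Position b l) →
                   ¬ Any (_Borders y) (Vec.map relabel P)
  relabel-avoids y∉ (e ∷ P) (here p) with ∈-map⁻ f (subst (_ ∈_) (boxes-relabel e) p)
  ... | x , _ , eq = y∉ x eq
  relabel-avoids y∉ (e ∷ P) (there p) = relabel-avoids y∉ P p

  degree-relabel : ∀ {l} (P : Position b l) x → degree (Vec.map relabel P) (f x) ≡ degree P x
  degree-relabel P x =
    count-map (borders? x) (borders? (f x)) relabel
      (λ {e} → relabel-borders⁺ {x} {e}) (λ {e} → relabel-borders⁻ {x} {e}) P

  degree-relabel-avoids : ∀ {y} → (∀ x → y ≢ f x) → ∀ {l} (P : Position b l) →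
                          degree (Vec.map relabel P) y ≡ 0
  degree-relabel-avoids y∉ P = count-none (borders? _) _ (relabel-avoids y∉ P)

↑ʳ≢↑ˡ : ∀ {b c} (x : Fin b) (y : Fin c) → b ↑ʳ y ≢ x ↑ˡ c
↑ʳ≢↑ˡ (suc x) y eq = ↑ʳ≢↑ˡ x y (suc-injective eq)

_⊎ₚ_ : ∀ {b c k l} → Position b k → Position c l → Position (b + c) (k + l)
_⊎ₚ_ {b} {c} P Q = Vec.map (relabel (_↑ˡ c) (↑ˡ-injective c)) P
                ++ Vec.map (relabel (b ↑ʳ_) (↑ʳ-injective b)) Q

module _ {b c k l} (P : Position b k) (Q : Position c l) where

  degree-↑ˡ : ∀ x → degree (P ⊎ₚ Q) (x ↑ˡ c) ≡ degree P x
  degree-↑ˡ x = begin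
    degree (P ⊎ₚ Q) (x ↑ˡ c)  ≡⟨ count-++ (borders? _) (Vec.map _ P) _ ⟩
    _                         ≡⟨ cong₂ _+_ (degree-relabel _ (↑ˡ-injective c) P x)
                                           (degree-relabel-avoids _ (↑ʳ-injective b)
                                             (λ y → ↑ʳ≢↑ˡ x y ∘ sym) Q) ⟩
    degree P x + 0            ≡⟨ +-identityʳ _ ⟩
    degree P x                ∎
    where open ≡-Reasoning

  degree-↑ʳ : ∀ y → degree (P ⊎ₚ Q) (b ↑ʳ y) ≡ degree Q y
  degree-↑ʳ y = begin
    degree (P ⊎ₚ Q) (b ↑ʳ y)  ≡⟨ count-++ (borders? _) (Vec.map _ P) _ ⟩
    _                         ≡⟨ cong₂ _+_ (degree-relabel-avoids _ (↑ˡ-injective c)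
                                             (λ x → ↑ʳ≢↑ˡ x y) P)
                                           (degree-relabel _ (↑ʳ-injective b) Q y) ⟩
    degree Q y                ∎
    where open ≡-Reasoning

∅ : Game
∅ = record { lines = [] {A = Line 0} ; degree-bounds = λ () }

infixl 6 _⊕_

_⊕_ : Game → Game → Game
G ⊕ H = record { lines = lines G ⊎ₚ lines H ; degree-bounds = bounds }
  where
  bounds : ∀ x → 1 ≤ degree (lines G ⊎ₚ lines H) x × degree (lines G ⊎ₚ lines H) x ≤ 4
  bounds x with splitAt (#boxes G) x in eq
  ... | inj₁ y rewrite sym (splitAt⁻¹-↑ˡ eq) | degree-↑ˡ (lines G) (lines H) y = degree-bounds G y
  ... | inj₂ y rewrite sym (splitAt⁻¹-↑ʳ eq) | degree-↑ʳ (lines G) (lines H) y = degree-bounds H y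

inˡ : (G H : Game) → Move G → Move (G ⊕ H)
inˡ G H m = m ↑ˡ #lines H

inʳ : (G H : Game) → Move H → Move (G ⊕ H)
inʳ G H m = #lines G ↑ʳ m

inject₁≢suc : ∀ {n} (i : Fin n) → inject₁ i ≢ suc i
inject₁≢suc (suc i) eq = inject₁≢suc i (suc-injective eq)

link : ∀ {k} → Fin k → Line (suc k)
link i = between (inject₁ i) (suc i) (inject₁≢suc i)

-- The lines e₁, …, eₖ joining consecutive boxes among b₁, …, bₖ₊₁.
path : ∀ k → Position (suc k) k
path k = tabulate link

chainLines : ∀ k → Position (suc k) (suc (suc k))
chainLines k = edge zero ∷ (path k ∷ʳ edge (fromℕ k))

loopLines : ∀ k → Position (suc (suc k)) (suc (suc k))
loopLines k = path (suc k) ∷ʳ between (fromℕ (suc k)) zero (λ ())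

∷ʳ⁺ : ∀ {A : Set} {P : Pred A 0ℓ} {n} {xs : Vec A n} y → Any P xs → Any P (xs ∷ʳ y)
∷ʳ⁺ y (here p)  = here p
∷ʳ⁺ y (there p) = there (∷ʳ⁺ y p)

link-borders-suc : ∀ {k} (x : Fin k) → Unclaimed (path k) (suc x)
link-borders-suc x = Any.tabulate⁺ x (there (here refl))

degree-path-≤ : ∀ k x → degree (path k) x ≤ 2
degree-path-≤ k x = ≤-trans
  (count-∪ starts? ends? (borders? x) link start-or-end (λ i → i))
  (+-mono-≤
    (count-tabulate-≤1 starts? (λ i → i) (λ i j p q → inject₁-injective (trans (sym p) q)))
    (count-tabulate-≤1 ends?   (λ i → i) (λ i j p q → suc-injective     (trans (sym p) q))))
  where
  starts? : Decidable (λ i → x ≡ inject₁ i)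
  starts? i = x ≟ inject₁ i

  ends? : Decidable (λ i → x ≡ suc i)
  ends? i = x ≟ suc i

  start-or-end : ∀ i → link i Borders x → x ≡ inject₁ i ⊎ x ≡ suc i
  start-or-end i (here p)         = inj₁ p
  start-or-end i (there (here p)) = inj₂ p

chain : (n : ℕ) → .{{NonZero n}} → Game
chain (suc k) = record { lines = chainLines k ; degree-bounds = bounds }
  where
  bordered : ∀ x → Unclaimed (chainLines k) x
  bordered zero    = here (here refl)
  bordered (suc x) = there (∷ʳ⁺ _ (link-borders-suc x))

  bounds : ∀ x → 1 ≤ degree (chainLines k) x × degree (chainLines k) x ≤ 4
  bounds x = count-any (borders? x) (bordered x)
           , count-∷-≤ (borders? x) (edge zero) (path k ∷ʳ edge (fromℕ k))
               (count-∷ʳ-≤ (borders? x) (path k) _ (degree-path-≤ k x))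

loop : (n : ℕ) → 4 ≤ n → Game
loop 1             (s≤s ())
loop (suc (suc k)) _ = record { lines = loopLines k ; degree-bounds = bounds }
  where
  bordered : ∀ x → Unclaimed (loopLines k) x
  bordered zero    = here (here refl)
  bordered (suc x) = ∷ʳ⁺ _ (link-borders-suc x)

  bounds : ∀ x → 1 ≤ degree (loopLines k) x × degree (loopLines k) x ≤ 4
  bounds x = count-any (borders? x) (bordered x)
           , m≤n⇒m≤1+n (count-∷ʳ-≤ (borders? x) (path (suc k)) _ (degree-path-≤ (suc k) x))

record EvenLoop : Set where
  field
    length : ℕ
    4≤     : 4 ≤ length
    even   : 2 ∣ length

open EvenLoop public

evenLoop : EvenLoop → Game
evenLoop L = loop (length L) (4≤ L)

loops : List EvenLoop → Game
loops = List.foldr (λ L G → evenLoop L ⊕ G) ∅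

{-# OPTIONS --safe #-}
module Submission where

-- If X has no box that can be claimed at once, the value w of X determines the value a + ∣ w - c ∣
-- of opening a further loop of n boxes (a = n - 4, c = 4) or 3-chain (a = 1, c = 2): the opponent
-- takes all boxes but c, and then either takes those too and opens X or leaves them and lets
-- the other player open X.  Hence the values of loops K and of K + 3 are minima over such options.
-- Changing the length of one loop by δ changes a value by at most δ, so the smallest loop is always
-- the best loop to open.  It remains to compare L with the 3-chain, writing k = v K, w = v (K + 3)
-- and n = length L - 4: this uses that k is even, w is odd and 1 ≤ w ≤ 1 + ∣ k - 2 ∣, and moreover
-- w ≥ 3 if n ≥ 2 and k ≢ 2, and k = 0 or k ≥ 8 if n ≥ 4.

open import Defs
open import Data.Fin.Base as Fin using (Fin; zero; suc; toℕ)
open import Data.Fin.Properties as Fin using (toℕ-injective)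
open import Data.Integer.Base as ℤ using (ℤ; +_; 0ℤ; _⊓_)
import Data.Integer.Properties as ℤ
open import Data.Integer.Tactic.RingSolver using (solve-∀)
open import Data.List.Base as List using (List; []; _∷_; _++_; applyUpTo; filter; initLast; upTo; _∷ʳ′_)
open import Data.List.Membership.DecPropositional using (_∈?_)
open import Data.List.Membership.Propositional using (_∈_)
open import Data.List.Membership.Propositional.Properties using (∈-map⁺; ∈-map⁻)
open import Data.List.Properties
  using (filter-++; length-++; filter-all; filter-none; ++-assoc; ++-identityʳ; ∷-injective; ∷ʳ-injective
        ; map-++; length-map; map-cong; map-id; upTo-∷ʳ; length-applyUpTo)
open import Data.List.Relation.Binary.Permutation.Propositional
  using (_↭_; refl; prep; swap; trans; ↭-sym; ↭-reflexive; ↭⇒↭ₛ)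
open import Data.List.Relation.Binary.Permutation.Propositional.Properties
  using (Any-resp-↭; All-resp-↭; ¬x∷xs↭[]; drop-∷; shift; shifts; ↭-length; ↭-singleton-inv; ↭-reverse
        ; filter-↭; ++⁺ʳ; ++⁺ˡ; ++-comm; ∷↭∷ʳ)
open import Data.List.Relation.Unary.All as All using (All; []; _∷_)
import Data.List.Relation.Unary.All.Properties as All
open import Data.List.Relation.Unary.AllPairs using ([]; _∷_)
open import Data.List.Relation.Unary.Any as Any using (Any; here; there)
import Data.List.Relation.Unary.Any.Properties as Any
open import Data.List.Relation.Unary.Unique.Propositional using (Unique)
open import Data.List.Relation.Unary.Unique.Propositional.Properties using (map⁺; upTo⁺)
open import Data.Nat.Base using (ℕ; zero; suc; _+_; _∸_; _≤_; _<_; z≤n; s≤s; ∣_-_∣; parity)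
open import Data.Nat.Divisibility.Core using (_∣_; divides)
import Data.Nat.Properties as ℕ
open import Data.Parity.Base as ℙ using (0ℙ; 1ℙ)
open import Data.Parity.Properties as ℙ using (+-homo-+; *-homo-*)
open import Data.Product.Base using (_×_; _,_; proj₁; proj₂; ∃; ∃₂)
open import Data.Sum.Base using (_⊎_; inj₁; inj₂; [_,_]′)
open import Data.Vec.Base as Vec
  using (Vec; []; _∷_; lookup; tabulate; removeAt; toList; fromList; foldr₁; count; allFin)
open import Data.Vec.Membership.Propositional.Properties using (∈-toList⁻; ∈-toList⁺; ∈-allFin⁺; ∈-lookup)
import Data.Vec.Properties as Vec
import Data.Vec.Relation.Unary.Any as VecAny
import Data.Vec.Relation.Unary.Any.Properties as VecAny
open import Function.Base using (_∘_; id)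
open import Level using (0ℓ)
open import Relation.Binary.PropositionalEquality as ≡
  using (_≡_; _≢_; sym; cong; cong₂; subst; subst₂; setoid; module ≡-Reasoning)
  renaming (refl to ≡-refl)
open import Relation.Nullary using (¬_; yes; no; ¬?; _×-dec_; contradiction; recompute)
open import Relation.Nullary.Decidable using (from-no)
open import Relation.Unary using (Pred; Decidable)

open import Data.List.Relation.Binary.Permutation.Setoid.Properties (setoid ℕ) using (Unique-resp-↭)

-- Claiming is not compulsory, so the value of an opened component is a minimum over all moves,
-- including poor ones: cutting what remains in the middle, or playing in X while boxes are on
-- offer. The lower bounds have to refute each of these. Their tool is an upper bound for an
-- arbitrary disjoint X, since after a move in X boxes of X may have become claimable: it says that
-- the opponent can take all that was left on offer, which already makes the move no better than the
-- intended ones. The two constants c are what the double-dealing move hands over. The remainder of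
-- a loop has no end line, so two pairs of boxes must be left behind; in a chain the line at the far
-- end leaves a single pair. What is not opened is again an endgame, so the same formula applies at
-- every stage and turns the game on lines into a game on components.

foldr₁-⊓-≤ : ∀ {n} (f : Fin (suc n) → ℤ) i → foldr₁ _⊓_ (tabulate f) ℤ.≤ f i
foldr₁-⊓-≤ {zero}  f zero    = ℤ.≤-refl
foldr₁-⊓-≤ {suc n} f zero    = ℤ.i⊓j≤i _ _
foldr₁-⊓-≤ {suc n} f (suc i) = ℤ.≤-trans (ℤ.i⊓j≤j (f zero) _) (foldr₁-⊓-≤ (f ∘ suc) i)

foldr₁-⊓-attained : ∀ {n} (f : Fin (suc n) → ℤ) → ∃ λ i → foldr₁ _⊓_ (tabulate f) ≡ f i
foldr₁-⊓-attained {zero}  f = zero , ≡-refl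
foldr₁-⊓-attained {suc n} f
  with ℤ.⊓-sel (f zero) (foldr₁ _⊓_ (tabulate (f ∘ suc))) | foldr₁-⊓-attained (f ∘ suc)
... | inj₁ eq | _       = zero , eq
... | inj₂ eq | i , eq′ = suc i , ≡.trans eq eq′

-- Minimax by removal of one element, up to permutation

removeAt-↭ : ∀ {A : Set} {l} (P : Vec A (suc l)) m →
             toList P ↭ lookup P m ∷ toList (removeAt P m)
removeAt-↭ (x ∷ xs)         zero    = refl
removeAt-↭ (x ∷ xs@(_ ∷ _)) (suc m) = trans (prep x (removeAt-↭ xs m)) (swap _ _ refl)

map-removeAt : ∀ {A B : Set} {l} (f : A → B) (P : Vec A (suc l)) m →
               Vec.map f (removeAt P m) ≡ removeAt (Vec.map f P) m
map-removeAt f (x ∷ xs)         zero    = ≡-refl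
map-removeAt f (x ∷ xs@(_ ∷ _)) (suc m) = cong (f x ∷_) (map-removeAt f xs m)

∈⇒↭∷ : ∀ {A : Set} {e : A} {P} → e ∈ P → ∃ λ R → P ↭ e ∷ R
∈⇒↭∷ (here ≡-refl)     = _ , refl
∈⇒↭∷ {P = x ∷ _} (there e∈) with R , p ← ∈⇒↭∷ e∈ = x ∷ R , trans (prep x p) (swap _ _ refl)

-- The case split behind every move in a union: the drawn line belongs to one summand and the other
-- stays as it is.
↭∷-++⁻ : ∀ {A : Set} {e : A} S {X R} → S ++ X ↭ e ∷ R →
         (∃ λ S′ → S ↭ e ∷ S′ × R ↭ S′ ++ X) ⊎ (∃ λ X′ → X ↭ e ∷ X′ × R ↭ S ++ X′)
↭∷-++⁻ []      p = inj₂ (_ , p , refl)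
↭∷-++⁻ {e = e} (s ∷ S) {X} p with Any-resp-↭ {P = e ≡_} (↭-sym p) (here ≡-refl)
... | here ≡-refl = inj₁ (S , refl , ↭-sym (drop-∷ p))
... | there e∈ with _ , q ← ∈⇒↭∷ e∈ with ↭∷-++⁻ S q
...   | inj₁ (S′ , S↭ , R↭) = inj₁ (s ∷ S′ , trans (prep s S↭) (swap _ _ refl) ,
        drop-∷ (trans (↭-sym p) (trans (prep s (trans q (prep e R↭))) (swap _ _ refl))))
...   | inj₂ (X′ , X↭ , R↭) = inj₂ (X′ , X↭ ,
        drop-∷ (trans (↭-sym p) (trans (prep s (trans q (prep e R↭))) (swap _ _ refl))))

-- The value of a game in which a move removes an element e of a list, leaving R,
-- and is worth option e R w when the rest of the game is worth w.
module Minimax {A : Set} (option : A → List A → ℤ → ℤ) where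

  minimum : ∀ {l} → Vec A l → ℤ
  minimum {zero}  _ = 0ℤ
  minimum {suc l} P =
    foldr₁ _⊓_ (tabulate λ m → option (lookup P m) (toList (removeAt P m)) (minimum (removeAt P m)))

  playing : ∀ {l} → Vec A (suc l) → Fin (suc l) → ℤ
  playing P m = option (lookup P m) (toList (removeAt P m)) (minimum (removeAt P m))

  minimum-attained : ∀ {l} (P : Vec A (suc l)) → ∃ λ m → minimum P ≡ playing P m
  minimum-attained P = foldr₁-⊓-attained (playing P)

  best : List A → ℤ
  best P = minimum (fromList P)

  module _ (option-↭ : ∀ e {R S} w → R ↭ S → option e R w ≡ option e S w) where

    -- The best move of `Q` also occurs in `P`, at index `i`, and leaves the same rest up to
    -- permutation. As `option` need not be monotone in the value of the rest, the recursion runs in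
    -- both directions to make these values equal.
    minimum-≤ : ∀ {k l} (P : Vec A k) (Q : Vec A l) → toList P ↭ toList Q → minimum P ℤ.≤ minimum Q
    minimum-≤ []        []        _ = ℤ.≤-refl
    minimum-≤ []        (_ ∷ _)   p = contradiction (↭-sym p) ¬x∷xs↭[]
    minimum-≤ (_ ∷ _)   []        p = contradiction p ¬x∷xs↭[]
    minimum-≤ P@(_ ∷ _) Q@(_ ∷ _) p with minimum-attained Q
    ... | m , eq = begin
      minimum P                              ≤⟨ foldr₁-⊓-≤ (playing P) i ⟩
      playing P i                            ≡⟨ option-↭ _ _ R↭S ⟩
      option (lookup P i) (toList (removeAt Q m)) (minimum (removeAt P i))
        ≡⟨ cong₂ (λ e w → option e (toList (removeAt Q m)) w) P[i]≡Q[m]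
             (ℤ.≤-antisym (minimum-≤ _ _ R↭S) (minimum-≤ _ _ (↭-sym R↭S))) ⟩
      _                                      ≡⟨ eq ⟨
      minimum Q                              ∎
      where
      open ℤ.≤-Reasoning
      Q[m]∈P : lookup Q m ∈ toList P
      Q[m]∈P = Any-resp-↭ (trans (↭-sym (removeAt-↭ Q m)) (↭-sym p)) (here ≡-refl)
      i : Fin _
      i = VecAny.index (∈-toList⁻ {xs = P} Q[m]∈P)
      P[i]≡Q[m] : lookup P i ≡ lookup Q m
      P[i]≡Q[m] = sym (VecAny.lookup-index (∈-toList⁻ {xs = P} Q[m]∈P))
      R↭S : toList (removeAt P i) ↭ toList (removeAt Q m)
      R↭S = drop-∷ {x = lookup Q m} (subst (λ e → e ∷ toList (removeAt P i) ↭ lookup Q m ∷ toList (removeAt Q m)) P[i]≡Q[m]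
              (trans (↭-sym (removeAt-↭ P i)) (trans p (removeAt-↭ Q m))))

    minimum-cong : ∀ {k l} (P : Vec A k) (Q : Vec A l) → toList P ↭ toList Q → minimum P ≡ minimum Q
    minimum-cong P Q p = ℤ.≤-antisym (minimum-≤ P Q p) (minimum-≤ Q P (↭-sym p))

    minimum≡best : ∀ {l} (P : Vec A l) → minimum P ≡ best (toList P)
    minimum≡best P = minimum-cong P _ (↭-reflexive (sym (Vec.toList∘fromList (toList P))))

    best-cong : ∀ {P Q} → P ↭ Q → best P ≡ best Q
    best-cong {P} {Q} p = minimum-cong (fromList P) (fromList Q)
      (subst₂ _↭_ (sym (Vec.toList∘fromList P)) (sym (Vec.toList∘fromList Q)) p)

    best-≤ : ∀ {P e R} → P ↭ e ∷ R → best P ℤ.≤ option e R (best R)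
    best-≤ {P} {e} {R} p = begin
      best P                        ≡⟨ best-cong p ⟩
      best (e ∷ R)                  ≤⟨ foldr₁-⊓-≤ (playing (e ∷ fromList R)) zero ⟩
      option e (toList (fromList R)) (best R)
        ≡⟨ cong (λ S → option e S (best R)) (Vec.toList∘fromList R) ⟩
      option e R (best R)           ∎
      where
      open ℤ.≤-Reasoning

    best-attained : ∀ x xs → ∃₂ λ e R → x ∷ xs ↭ e ∷ R × best (x ∷ xs) ≡ option e R (best R)
    best-attained x xs with minimum-attained (x ∷ fromList xs)
    ... | m , eq =
      lookup (x ∷ fromList xs) m , toList (removeAt (x ∷ fromList xs) m)
      , trans (↭-reflexive (cong (x ∷_) (sym (Vec.toList∘fromList xs)))) (removeAt-↭ (x ∷ fromList xs) m)
      , ≡.trans eq (cong (option _ _) (minimum≡best (removeAt (x ∷ fromList xs) m)))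

-- Positions as hypergraphs

-- A line is the list of the boxes that it borders.  Boxes are natural numbers, so that
-- a disjoint union is a concatenation whose left summand is not relabelled.
Pos : Set
Pos = List (List ℕ)

infix 4 _On_

_On_ : ℕ → Pos → Set
x On P = Any (x ∈_) P

on? : ∀ P → Decidable (_On P)
on? P x = Any.any? (_∈?_ ℕ._≟_ x) P

opaque

  gain : List ℕ → Pos → ℕ
  gain e R = List.length (filter (λ x → ¬? (on? R x)) e)

  gain-↭ : ∀ {e e′ R} → e ↭ e′ → gain e R ≡ gain e′ R
  gain-↭ {R = R} p = ↭-length (filter-↭ (λ x → ¬? (on? R x)) p)

  gain-++ : ∀ e e′ R → gain (e ++ e′) R ≡ gain e R + gain e′ R
  gain-++ e e′ R = ≡.trans (cong List.length (filter-++ Q? e e′)) (length-++ (filter Q? e))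
    where
    Q? : Decidable (λ x → ¬ x On R)
    Q? x = ¬? (on? R x)

  gain-0 : ∀ {e R} → (∀ {x} → x ∈ e → x On R) → gain e R ≡ 0
  gain-0 {e} {R} on = cong List.length (filter-none (λ x → ¬? (on? R x)) (All.tabulate (λ x∈ x∉ → x∉ (on x∈))))

  gain-all : ∀ {e R} → (∀ {x} → x ∈ e → ¬ x On R) → gain e R ≡ List.length e
  gain-all {e} {R} off = cong List.length (filter-all (λ x → ¬? (on? R x)) (All.tabulate off))

  gain-cong : ∀ e {R S} → (∀ {x} → x ∈ e → x On R → x On S) → (∀ {x} → x ∈ e → x On S → x On R) →
              gain e R ≡ gain e S
  gain-cong []      R⊆S S⊆R = ≡-refl
  gain-cong (x ∷ e) {R} {S} R⊆S S⊆R with on? R x | on? S x | gain-cong e {R} {S} (R⊆S ∘ there) (S⊆R ∘ there)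
  ... | yes _   | yes _   | ih = ih
  ... | no  _   | no  _   | ih = cong suc ih
  ... | yes x∈R | no  x∉S | _  = contradiction (R⊆S (here ≡-refl) x∈R) x∉S
  ... | no  x∉R | yes x∈S | _  = contradiction (S⊆R (here ≡-refl) x∈S) x∉R

private module Hypergraph = Minimax (λ e R → afterClaiming (gain e R))
open Hypergraph using (playing; minimum)

after-↭ : ∀ e {R S} w → R ↭ S → afterClaiming (gain e R) w ≡ afterClaiming (gain e S) w
after-↭ e w p =
  cong (λ k → afterClaiming k w) (gain-cong e (λ _ → Any-resp-↭ p) (λ _ → Any-resp-↭ (↭-sym p)))

opaque

  V : Pos → ℤ
  V = Hypergraph.best

  V-[] : V [] ≡ 0ℤ
  V-[] = ≡-refl

  minimum≡V : ∀ {l} (P : Vec (List ℕ) l) → minimum P ≡ V (toList P)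
  minimum≡V = Hypergraph.minimum≡best after-↭

  V-cong : ∀ {P Q} → P ↭ Q → V P ≡ V Q
  V-cong = Hypergraph.best-cong after-↭

  V-≤ : ∀ {P e R} → P ↭ e ∷ R → V P ℤ.≤ afterClaiming (gain e R) (V R)
  V-≤ = Hypergraph.best-≤ after-↭

  V-attained : ∀ x xs → ∃₂ λ e R → x ∷ xs ↭ e ∷ R × V (x ∷ xs) ≡ afterClaiming (gain e R) (V R)
  V-attained = Hypergraph.best-attained after-↭

-- From claims in a `Position` to gains in a hypergraph

module _ {A : Set} {P Q R : Pred A 0ℓ} (P? : Decidable P) (Q? : Decidable Q) (R? : Decidable R) where

  count-⊎ : (∀ {x} → R x → P x ⊎ Q x) → (∀ {x} → P x → R x) → (∀ {x} → Q x → R x) →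
            (∀ {x} → P x → ¬ Q x) → ∀ {n} (xs : Vec A n) → count R? xs ≡ count P? xs + count Q? xs
  count-⊎ R⇒ P⇒ Q⇒ P#Q []       = ≡-refl
  count-⊎ R⇒ P⇒ Q⇒ P#Q (x ∷ xs) with R? x | P? x | Q? x | count-⊎ R⇒ P⇒ Q⇒ P#Q xs
  ... | _      | yes p | yes q | _  = contradiction q (P#Q p)
  ... | yes _  | yes _ | no  _ | ih = cong suc ih
  ... | yes _  | no  _ | yes _ | ih = ≡.trans (cong suc ih) (sym (ℕ.+-suc _ _))
  ... | yes r  | no ¬p | no ¬q | _  = contradiction (R⇒ r) [ ¬p , ¬q ]′
  ... | no ¬r  | yes p | no  _ | _  = contradiction (P⇒ p) ¬r
  ... | no ¬r  | no  _ | yes q | _  = contradiction (Q⇒ q) ¬r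
  ... | no  _  | no  _ | no  _ | ih = ih

module _ {b} {Q : Pred (Fin b) 0ℓ} (Q? : Decidable Q) where

  count-single : ∀ a → count (λ x → (x Fin.≟ a) ×-dec Q? x) (allFin b) ≡ List.length (filter Q? (a ∷ []))
  count-single a with Q? a
  ... | yes q = ℕ.≤-antisym
    (count-tabulate-≤1 (λ x → (x Fin.≟ a) ×-dec Q? x) id (λ _ _ p r → ≡.trans (proj₁ p) (sym (proj₁ r))))
    (count-any (λ x → (x Fin.≟ a) ×-dec Q? x) (VecAny.map (λ { ≡-refl → ≡-refl , q }) (∈-allFin⁺ a)))
  ... | no ¬q = count-none (λ x → (x Fin.≟ a) ×-dec Q? x) (allFin b)
    (λ p → case-lookup (VecAny.lookup-index p))
    where
    case-lookup : ∀ {x} → ¬ (x ≡ a × Q x)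
    case-lookup (≡-refl , q) = ¬q q

  -- `claims` runs over all boxes of the position, `gain` only over the entries of a line. The
  -- counts agree because a line lists no box twice.
  count-∈ : ∀ {e} → Unique e →
            count (λ x → _∈?_ Fin._≟_ x e ×-dec Q? x) (allFin b) ≡ List.length (filter Q? e)
  count-∈ {[]}    _ = count-none (λ x → _∈?_ Fin._≟_ x [] ×-dec Q? x) (allFin b)
    (λ p → none (VecAny.lookup-index p))
    where
    none : ∀ {x} → ¬ (x ∈ [] × Q x)
    none ()
  count-∈ {a ∷ e} (a∉e ∷ unique) = begin
    count (λ x → _∈?_ Fin._≟_ x (a ∷ e) ×-dec Q? x) (allFin b)
      ≡⟨ count-⊎ (λ x → (x Fin.≟ a) ×-dec Q? x) (λ x → _∈?_ Fin._≟_ x e ×-dec Q? x) _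
           (λ { (here eq , q) → inj₁ (eq , q) ; (there x∈ , q) → inj₂ (x∈ , q) })
           (λ (eq , q) → here eq , q) (λ (x∈ , q) → there x∈ , q)
           (λ { (≡-refl , _) (x∈ , _) → All.lookup a∉e x∈ ≡-refl }) (allFin b) ⟩
    count (λ x → (x Fin.≟ a) ×-dec Q? x) (allFin b) + count (λ x → _∈?_ Fin._≟_ x e ×-dec Q? x) (allFin b)
      ≡⟨ cong₂ _+_ (count-single a) (count-∈ unique) ⟩
    List.length (filter Q? (a ∷ [])) + List.length (filter Q? e)
      ≡⟨ length-++ (filter Q? (a ∷ [])) ⟨
    List.length (filter Q? (a ∷ []) ++ filter Q? e)
      ≡⟨ cong List.length (filter-++ Q? (a ∷ []) e) ⟨
    List.length (filter Q? (a ∷ e)) ∎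
    where open ≡-Reasoning

length-filter-map : ∀ {A B : Set} {P : Pred A 0ℓ} {Q : Pred B 0ℓ} (P? : Decidable P) (Q? : Decidable Q)
                    (f : A → B) → (∀ {x} → P x → Q (f x)) → (∀ {x} → Q (f x) → P x) →
                    ∀ xs → List.length (filter P? xs) ≡ List.length (filter Q? (List.map f xs))
length-filter-map P? Q? f P⇒Q Q⇒P []       = ≡-refl
length-filter-map P? Q? f P⇒Q Q⇒P (x ∷ xs) with P? x | Q? (f x)
... | yes _ | yes _ = cong suc (length-filter-map P? Q? f P⇒Q Q⇒P xs)
... | no  _ | no  _ = length-filter-map P? Q? f P⇒Q Q⇒P xs
... | yes p | no ¬q = contradiction (P⇒Q p) ¬q
... | no ¬p | yes q = contradiction (Q⇒P q) ¬p

labels : ∀ {b} → Line b → List ℕ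
labels e = List.map toℕ (boxes e)

hyper : ∀ {b l} → Position b l → Pos
hyper P = toList (Vec.map labels P)

boxes-unique : ∀ {b} (e : Line b) → Unique (boxes e)
boxes-unique (edge x)          = [] ∷ []
boxes-unique (between x y x≢y) = (recompute (¬? (x Fin.≟ y)) x≢y ∷ []) ∷ [] ∷ []

∈-labels⁺ : ∀ {b x} (e : Line b) → e Borders x → toℕ x ∈ labels e
∈-labels⁺ e = ∈-map⁺ toℕ

∈-labels⁻ : ∀ {b x} (e : Line b) → toℕ x ∈ labels e → e Borders x
∈-labels⁻ e x∈ with y , y∈ , eq ← ∈-map⁻ toℕ x∈ = subst (_∈ boxes e) (sym (toℕ-injective eq)) y∈

module _ {b l} {x : Fin b} (P : Position b l) where

  unclaimed⇒on : Unclaimed P x → toℕ x On hyper P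
  unclaimed⇒on = VecAny.toList⁺ ∘ VecAny.map⁺ ∘ VecAny.map (λ {e} → ∈-labels⁺ e)

  on⇒unclaimed : toℕ x On hyper P → Unclaimed P x
  on⇒unclaimed = VecAny.map (λ {e} → ∈-labels⁻ e) ∘ VecAny.map⁻ ∘ VecAny.toList⁻

opaque
  unfolding gain

  claims≡gain : ∀ {b l} (P : Position b (suc l)) m →
                claims P m ≡ gain (labels (lookup P m)) (hyper (removeAt P m))
  claims≡gain P m = ≡.trans
    (count-∈ (λ x → ¬? (unclaimed? (removeAt P m) x)) (boxes-unique (lookup P m)))
    (length-filter-map _ _ toℕ (λ x∉ → x∉ ∘ on⇒unclaimed (removeAt P m)) (λ x∉ → x∉ ∘ unclaimed⇒on (removeAt P m))
      (boxes (lookup P m)))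

value≡minimum     : ∀ {b l} (P : Position b l) → value P ≡ minimum (Vec.map labels P)
moveValue≡playing : ∀ {b l} (P : Position b (suc l)) m → moveValue P m ≡ playing (Vec.map labels P) m

value≡minimum {l = zero}  P = ≡-refl
value≡minimum {l = suc l} P = cong (foldr₁ _⊓_) (Vec.tabulate-cong (moveValue≡playing P))

moveValue≡playing P m = begin
  afterClaiming (claims P m) (value (removeAt P m))
    ≡⟨ cong₂ afterClaiming (claims≡gain P m) (value≡minimum (removeAt P m)) ⟩
  afterClaiming (gain (labels (lookup P m)) (toList R)) (minimum R)
    ≡⟨ cong₂ (λ e R → afterClaiming (gain e (toList R)) (minimum R))
         (Vec.lookup-map m labels P) (sym (map-removeAt labels P m)) ⟨
  playing (Vec.map labels P) m ∎
  where
  open ≡-Reasoning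
  R = Vec.map labels (removeAt P m)

value≡V : ∀ {b l} (P : Position b l) → value P ≡ V (hyper P)
value≡V P = ≡.trans (value≡minimum P) (minimum≡V (Vec.map labels P))

moveValue≡after : ∀ {b l} (P : Position b l) m → ∃ λ R →
                  hyper P ↭ labels (lookup P m) ∷ R ×
                  moveValue P m ≡ afterClaiming (gain (labels (lookup P m)) R) (V R)
moveValue≡after {l = suc l} P m =
    hyper (removeAt P m)
  , trans (removeAt-↭ (Vec.map labels P) m)
      (↭-reflexive (cong₂ (λ e R → e ∷ toList R) (Vec.lookup-map m labels P) (sym (map-removeAt labels P m))))
  , cong₂ afterClaiming (claims≡gain P m) (value≡V (removeAt P m))

-- Certificates for linear inequalities: the identity, left to the ring solver, writes the slack of
-- the goal as the sum of the slacks of the hypotheses.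
by-sum : ∀ {i j x y} → i ℤ.≤ j → y ℤ.- x ≡ j ℤ.- i → x ℤ.≤ y
by-sum i≤j eq = ℤ.0≤i-j⇒j≤i (subst (0ℤ ℤ.≤_) (sym eq) (ℤ.i≤j⇒0≤j-i i≤j))

by-sum₂ : ∀ {i j k l x y} → i ℤ.≤ j → k ℤ.≤ l → y ℤ.- x ≡ (j ℤ.- i) ℤ.+ (l ℤ.- k) → x ℤ.≤ y
by-sum₂ i≤j k≤l eq = ℤ.0≤i-j⇒j≤i (subst (0ℤ ℤ.≤_) (sym eq)
  (ℤ.+-mono-≤ (ℤ.i≤j⇒0≤j-i i≤j) (ℤ.i≤j⇒0≤j-i k≤l)))

by-sum₃ : ∀ {i j k l m n x y} → i ℤ.≤ j → k ℤ.≤ l → m ℤ.≤ n →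
          y ℤ.- x ≡ (j ℤ.- i) ℤ.+ ((l ℤ.- k) ℤ.+ (n ℤ.- m)) → x ℤ.≤ y
by-sum₃ i≤j k≤l m≤n eq = ℤ.0≤i-j⇒j≤i (subst (0ℤ ℤ.≤_) (sym eq)
  (ℤ.+-mono-≤ (ℤ.i≤j⇒0≤j-i i≤j) (ℤ.+-mono-≤ (ℤ.i≤j⇒0≤j-i k≤l) (ℤ.i≤j⇒0≤j-i m≤n))))

-- Isolated lines and captureless positions

infix 4 _♯_

_♯_ : List ℕ → Pos → Set
zs ♯ X = ∀ {x} → x ∈ zs → ¬ x On X

♯-↭ : ∀ {zs X Y} → zs ♯ X → X ↭ Y → zs ♯ Y
♯-↭ zs♯X p z∈ z∈Y = zs♯X z∈ (Any-resp-↭ (↭-sym p) z∈Y)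

♯-++ : ∀ {zs X Y} → zs ♯ X → zs ♯ Y → zs ♯ X ++ Y
♯-++ {X = X} zs♯X zs♯Y z∈ z∈XY = [ zs♯X z∈ , zs♯Y z∈ ]′ (Any.++⁻ X z∈XY)

gain-1 : ∀ {e x y R} → e ↭ x ∷ y ∷ [] → ¬ x On R → y On R → gain e R ≡ 1
gain-1 {e} {x} {y} {R} p x∉ y∈ = begin
  gain e R                               ≡⟨ gain-↭ p ⟩
  gain (x ∷ y ∷ []) R                    ≡⟨ gain-++ (x ∷ []) (y ∷ []) R ⟩
  gain (x ∷ []) R + gain (y ∷ []) R      ≡⟨ cong₂ _+_ (gain-all {x ∷ []} λ { (here ≡-refl) → x∉ })
                                                      (gain-0 {y ∷ []} λ { (here ≡-refl) → y∈ }) ⟩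
  1                                      ∎
  where open ≡-Reasoning

V-≤-gain : ∀ {P e R k w} → P ↭ e ∷ R → gain e R ≡ k → V R ≡ w → V P ℤ.≤ afterClaiming k w
V-≤-gain p ≡-refl ≡-refl = V-≤ p

isolated-≤ : ∀ {a e X} → a ∷ e ♯ X → V ((a ∷ e) ∷ X) ℤ.≤ V X ℤ.- + suc (List.length e)
isolated-≤ e♯X = V-≤-gain refl (gain-all e♯X) ≡-refl

-- Postponing a line that shares no box with X hands all its boxes to the opponent.
isolated-≥ : ∀ n {a e X} → List.length X ≡ n → a ∷ e ♯ X →
             V X ℤ.- + suc (List.length e) ℤ.≤ V ((a ∷ e) ∷ X)
isolated-≥ n {a} {e} {X} len e♯X = from-attained (V-attained (a ∷ e) X)
  where
  k = + suc (List.length e)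
  from-attained : (∃₂ λ e′ R → (a ∷ e) ∷ X ↭ e′ ∷ R × V ((a ∷ e) ∷ X) ≡ afterClaiming (gain e′ R) (V R)) →
                  V X ℤ.- k ℤ.≤ V ((a ∷ e) ∷ X)
  playing-≥ : ∀ n → List.length X ≡ n → ∀ e′ R →
    (∃ λ S′ → (a ∷ e) ∷ [] ↭ e′ ∷ S′ × R ↭ S′ ++ X) ⊎ (∃ λ X′ → X ↭ e′ ∷ X′ × R ↭ (a ∷ e) ∷ X′) →
    V X ℤ.- k ℤ.≤ afterClaiming (gain e′ R) (V R)
  from-attained (e′ , R , p , eq) =
    subst (V X ℤ.- k ℤ.≤_) (sym eq) (playing-≥ n len e′ R (↭∷-++⁻ ((a ∷ e) ∷ []) p))
  playing-≥ n len e′ R (inj₁ (S′ , p , q)) with ≡-refl ← ↭-singleton-inv (↭-sym p) =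
    ℤ.≤-reflexive (sym (cong₂ afterClaiming (gain-all (♯-↭ e♯X (↭-sym q))) (V-cong q)))
  playing-≥ zero    len e′ R (inj₂ (X′ , p , q)) = contradiction (≡.trans (sym (↭-length p)) len) (λ ())
  playing-≥ (suc n) len e′ R (inj₂ (X′ , p , q)) =
    -- As `e′` shares no box with the isolated line, it claims equally many boxes in its presence
    -- and in its absence.
    subst₂ (λ g w → V X ℤ.- k ℤ.≤ afterClaiming g w)
      (gain-cong e′ (λ _ → Any-resp-↭ (↭-sym q) ∘ there) on⇒) (V-cong (↭-sym q))
      (main (gain e′ X′) (V-≤ p))
    where
    e♯X′ : a ∷ e ♯ X′
    e♯X′ x∈ x∈X′ = e♯X x∈ (Any-resp-↭ (↭-sym p) (there x∈X′))
    on⇒ : ∀ {x} → x ∈ e′ → x On R → x On X′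
    on⇒ x∈e′ x∈R with Any-resp-↭ q x∈R
    ... | here x∈e   = contradiction (Any-resp-↭ (↭-sym p) (here x∈e′)) (e♯X x∈e)
    ... | there x∈X′ = x∈X′
    main : ∀ g → V X ℤ.≤ afterClaiming g (V X′) → V X ℤ.- k ℤ.≤ afterClaiming g (V ((a ∷ e) ∷ X′))
    -- The turn passes and the opponent can claim the `k` boxes. Compared with claiming them first
    -- this loses `2k`, the third slack.
    main zero    X≤ = by-sum₃ X≤ (isolated-≤ e♯X′) (ℤ.-≤+ {List.length e} {suc (List.length e)})
      (eq (V X) (V X′) (V ((a ∷ e) ∷ X′)) k)
      where
      eq : ∀ x x′ y k → (ℤ.- y) ℤ.- (x ℤ.- k) ≡ (ℤ.- x′ ℤ.- x) ℤ.+ (((x′ ℤ.- k) ℤ.- y) ℤ.+ (k ℤ.- (ℤ.- k)))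
      eq = solve-∀
    main (suc g) X≤ = by-sum₂ X≤ (isolated-≥ n (ℕ.suc-injective (≡.trans (sym (↭-length p)) len)) e♯X′)
      (eq (V X) (V X′) (V ((a ∷ e) ∷ X′)) k (+ suc g))
      where
      eq : ∀ x x′ y k g → (y ℤ.- g) ℤ.- (x ℤ.- k) ≡ ((x′ ℤ.- g) ℤ.- x) ℤ.+ (y ℤ.- (x′ ℤ.- k))
      eq = solve-∀

isolated : ∀ {a e X} → a ∷ e ♯ X → V ((a ∷ e) ∷ X) ≡ V X ℤ.- + suc (List.length e)
isolated e♯X = ℤ.≤-antisym (isolated-≤ e♯X) (isolated-≥ _ ≡-refl e♯X)

Captureless : Pos → Set
Captureless X = ∀ {e R} → X ↭ e ∷ R → ∀ {x} → x ∈ e → x On R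

captureless-≤ : ∀ {X e R} → Captureless X → X ↭ e ∷ R → V X ℤ.≤ ℤ.- V R
captureless-≤ captureless p = V-≤-gain p (gain-0 (captureless p)) ≡-refl

captureless-++ : ∀ {X Y} → Captureless X → Captureless Y → Captureless (X ++ Y)
captureless-++ {X} cX cY p x∈ with ↭∷-++⁻ X p
... | inj₁ (_ , q , r) = Any-resp-↭ (↭-sym r) (Any.++⁺ˡ (cX q x∈))
... | inj₂ (_ , q , r) = Any-resp-↭ (↭-sym r) (Any.++⁺ʳ X (cY q x∈))

-- An optimal move sorted by the part in which it is made. As X will be captureless, a move there
-- passes the turn, which gives the sign in `outside`.
data BestMove (S X : Pos) : Set where
  inside  : ∀ {e S′} → S ↭ e ∷ S′ →
            V (S ++ X) ≡ afterClaiming (gain e (S′ ++ X)) (V (S′ ++ X)) → BestMove S X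
  outside : ∀ {e X′} → X ↭ e ∷ X′ → V (S ++ X) ≡ ℤ.- V (S ++ X′) → BestMove S X

option-cong : ∀ e {R S} → R ↭ S → afterClaiming (gain e R) (V R) ≡ afterClaiming (gain e S) (V S)
option-cong e {R} {S} p = ≡.trans (after-↭ e (V R) p) (cong (afterClaiming (gain e S)) (V-cong p))

bestMove : ∀ s S {X} → Captureless X → BestMove (s ∷ S) X
bestMove s S {X} captureless with V-attained s (S ++ X)
... | e , R , p , eq with ↭∷-++⁻ (s ∷ S) p
...   | inj₁ (S′ , q , r) = inside q (≡.trans eq (option-cong e r))
...   | inj₂ (X′ , q , r) = outside q (≡.trans eq (cong₂ afterClaiming
          (gain-0 (λ x∈ → Any-resp-↭ (↭-sym r) (Any.++⁺ʳ (s ∷ S) (captureless q x∈)))) (V-cong r)))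

♯-tail : ∀ {zs X e X′} → zs ♯ X → X ↭ e ∷ X′ → zs ♯ X′
♯-tail zs♯X p x∈ x∈X′ = zs♯X x∈ (Any-resp-↭ (↭-sym p) (there x∈X′))

-- Strings: chains without their two end lines

string : List ℕ → Pos
string []           = []
string (x ∷ [])     = []
string (x ∷ y ∷ zs) = (x ∷ y ∷ []) ∷ string (y ∷ zs)

string-⊆ : ∀ zs {x} → x On string zs → x ∈ zs
string-⊆ (x ∷ y ∷ zs) (here (here eq))         = here eq
string-⊆ (x ∷ y ∷ zs) (here (there (here eq))) = there (here eq)
string-⊆ (x ∷ y ∷ zs) (there p)                = there (string-⊆ (y ∷ zs) p)

⊆-string : ∀ zs {z} → 2 ≤ List.length zs → z ∈ zs → z On string zs
⊆-string (x ∷ [])          (s≤s ())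
⊆-string (x ∷ y ∷ zs)     _ (here eq)         = here (here eq)
⊆-string (x ∷ y ∷ zs)     _ (there (here eq)) = here (there (here eq))
⊆-string (x ∷ y ∷ w ∷ zs) _ (there (there p)) = there (⊆-string (y ∷ w ∷ zs) (s≤s (s≤s z≤n)) (there p))

string-++ : ∀ as z bs → string (as ++ z ∷ bs) ≡ string (as ++ z ∷ []) ++ string (z ∷ bs)
string-++ []           z bs = ≡-refl
string-++ (a ∷ [])     z bs = ≡-refl
string-++ (a ∷ c ∷ as) z bs = cong (_ ∷_) (string-++ (c ∷ as) z bs)

∈-string⁻ : ∀ {e} zs → e ∈ string zs →
            ∃₂ λ as bs → ∃₂ λ x y → zs ≡ as ++ x ∷ y ∷ bs × e ≡ x ∷ y ∷ []
∈-string⁻ (x ∷ y ∷ zs) (here eq)  = [] , zs , x , y , ≡-refl , eq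
∈-string⁻ (x ∷ y ∷ zs) (there e∈) with as , bs , u , w , eq , e≡ ← ∈-string⁻ (y ∷ zs) e∈ =
  x ∷ as , bs , u , w , cong (x ∷_) eq , e≡

-- If `as` is empty, the first part has no line and its box `x` has been claimed; likewise `y` if
-- `bs` is empty. Claiming and cutting thus need no separate description.
string-cut : ∀ {e S′} zs → string zs ↭ e ∷ S′ →
             ∃₂ λ as bs → ∃₂ λ x y → zs ≡ as ++ x ∷ y ∷ bs × e ≡ x ∷ y ∷ [] ×
             S′ ↭ string (as ++ x ∷ []) ++ string (y ∷ bs)
string-cut zs p with as , bs , x , y , ≡-refl , ≡-refl ← ∈-string⁻ zs (Any-resp-↭ (↭-sym p) (here ≡-refl)) =
  as , bs , x , y , ≡-refl , ≡-refl ,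
  drop-∷ (trans (↭-sym p) (trans (↭-reflexive (string-++ as x (y ∷ bs)))
    (shift (x ∷ y ∷ []) (string (as ++ x ∷ [])) (string (y ∷ bs)))))

unique-++⁻ : ∀ as {bs : List ℕ} → Unique (as ++ bs) →
             Unique as × Unique bs × (∀ {x} → x ∈ as → ¬ x ∈ bs)
unique-++⁻ []       u       = [] , u , λ ()
unique-++⁻ (a ∷ as) (a∉ ∷ u) with ua , ub , disjoint ← unique-++⁻ as u =
  (All.++⁻ˡ as a∉ ∷ ua) , ub ,
  λ { (here ≡-refl) x∈ → All.lookup (All.++⁻ʳ as a∉) x∈ ≡-refl ; (there x∈as) → disjoint x∈as }

♯-string : ∀ {x zs X} → All (x ≢_) zs → ¬ x On X → ¬ x On string zs ++ X
♯-string {zs = zs} x∉zs x∉X p with Any.++⁻ (string zs) p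
... | inj₁ q = All.lookup x∉zs (string-⊆ zs q) ≡-refl
... | inj₂ q = x∉X q

string-take-≤ : ∀ x y z zs {X} → Unique (x ∷ y ∷ z ∷ zs) → x ∷ y ∷ z ∷ zs ♯ X →
                V (string (x ∷ y ∷ z ∷ zs) ++ X) ℤ.≤ V (string (y ∷ z ∷ zs) ++ X) ℤ.- + 1
string-take-≤ x y z zs (x∉ ∷ _) zs♯X =
  V-≤-gain refl (gain-1 refl (♯-string x∉ (zs♯X (here ≡-refl))) (here (here ≡-refl))) ≡-refl

-- The greedy strategy: each line from the left claims one box and the last line claims two, after
-- which the mover is still on turn and faces X.
string-≤₁ : ∀ x y zs {X} → Unique (x ∷ y ∷ zs) → x ∷ y ∷ zs ♯ X →
            V (string (x ∷ y ∷ zs) ++ X) ℤ.≤ V X ℤ.- + (2 + List.length zs)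
string-≤₁ x y []           u       zs♯X = isolated-≤ zs♯X
string-≤₁ x y (z ∷ zs) {X} u@(_ ∷ u′) zs♯X = begin
  V (string (x ∷ y ∷ z ∷ zs) ++ X)          ≤⟨ string-take-≤ x y z zs u zs♯X ⟩
  V (string (y ∷ z ∷ zs) ++ X) ℤ.- + 1      ≤⟨ ℤ.+-monoˡ-≤ (ℤ.- + 1) (string-≤₁ y z zs u′ (zs♯X ∘ there)) ⟩
  V X ℤ.- + (2 + List.length zs) ℤ.- + 1         ≡⟨ eq (V X) (+ (2 + List.length zs)) ⟩
  V X ℤ.- + (3 + List.length zs)                 ∎
  where
  open ℤ.≤-Reasoning
  eq : ∀ v n → v ℤ.- n ℤ.- + 1 ≡ v ℤ.- (+ 1 ℤ.+ n)
  eq = solve-∀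

-- The player claims boxes from one end until four are left, and then draws the middle one of
-- their three lines: this leaves two pairs of boxes to the opponent, who must then open X.
string-≤₂ : ∀ x y z w zs {X} → Unique (x ∷ y ∷ z ∷ w ∷ zs) → x ∷ y ∷ z ∷ w ∷ zs ♯ X →
            V (string (x ∷ y ∷ z ∷ w ∷ zs) ++ X) ℤ.≤ + 4 ℤ.- + List.length zs ℤ.- V X
string-≤₂ x y z w [] {X} (x∉ ∷ y∉ ∷ _) zs♯X = ℤ.≤-trans
  (V-≤-gain (swap _ _ refl)
    (gain-0 λ { (here ≡-refl) → here (there (here ≡-refl)) ; (there (here ≡-refl)) → there (here (here ≡-refl)) })
    (≡.trans (isolated xy♯) (cong (ℤ._- + 2) (isolated (λ v∈ → zs♯X (there (there v∈)))))))
  (ℤ.≤-reflexive (eq (V X)))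
  where
  xy♯ : x ∷ y ∷ [] ♯ (z ∷ w ∷ []) ∷ X
  xy♯ (here ≡-refl) = ♯-string {zs = z ∷ w ∷ []} (All.tail x∉) (zs♯X (here ≡-refl))
  xy♯ (there (here ≡-refl)) = ♯-string {zs = z ∷ w ∷ []} y∉ (zs♯X (there (here ≡-refl)))
  eq : ∀ v → ℤ.- (v ℤ.- + 2 ℤ.- + 2) ≡ + 4 ℤ.- + 0 ℤ.- v
  eq = solve-∀
string-≤₂ x y z w (t ∷ zs) {X} u@(_ ∷ u′) zs♯X = begin
  V (string (x ∷ y ∷ z ∷ w ∷ t ∷ zs) ++ X)      ≤⟨ string-take-≤ x y z (w ∷ t ∷ zs) u zs♯X ⟩
  V (string (y ∷ z ∷ w ∷ t ∷ zs) ++ X) ℤ.- + 1  ≤⟨ ℤ.+-monoˡ-≤ (ℤ.- + 1) (string-≤₂ y z w t zs u′ (zs♯X ∘ there)) ⟩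
  + 4 ℤ.- + List.length zs ℤ.- V X ℤ.- + 1           ≡⟨ eq (V X) (+ List.length zs) ⟩
  + 4 ℤ.- + (suc (List.length zs)) ℤ.- V X           ∎
  where
  open ℤ.≤-Reasoning
  eq : ∀ v n → + 4 ℤ.- n ℤ.- v ℤ.- + 1 ≡ + 4 ℤ.- (+ 1 ℤ.+ n) ℤ.- v
  eq = solve-∀

string-≤ : ∀ zs {X} → 2 ≤ List.length zs → Unique zs → zs ♯ X →
           V (string zs ++ X) ℤ.≤ V X ℤ.- + List.length zs
string-≤ (_ ∷ [])     (s≤s ())
string-≤ (x ∷ y ∷ zs) _ = string-≤₁ x y zs

-- For the position after a cut in the middle: the opponent, now on turn, can claim both parts
-- entirely.
string²-≤ : ∀ as bs {X} → 2 ≤ List.length as → 2 ≤ List.length bs → Unique (as ++ bs) → as ++ bs ♯ X →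
            V (string as ++ string bs ++ X) ℤ.≤ V X ℤ.- + List.length (as ++ bs)
string²-≤ as bs {X} 2≤as 2≤bs u zs♯X with ua , ub , disjoint ← unique-++⁻ as u = begin
  V (string as ++ string bs ++ X)
    ≤⟨ string-≤ as 2≤as ua (♯-++ (λ x∈as → disjoint x∈as ∘ string-⊆ bs) (zs♯X ∘ Any.++⁺ˡ)) ⟩
  V (string bs ++ X) ℤ.- + a
    ≤⟨ ℤ.+-monoˡ-≤ (ℤ.- + a) (string-≤ bs 2≤bs ub (zs♯X ∘ Any.++⁺ʳ as)) ⟩
  V X ℤ.- + b ℤ.- + a            ≡⟨ eq (V X) (+ a) (+ b) ⟩
  V X ℤ.- + (a + b)              ≡⟨ cong (λ n → V X ℤ.- + n) (length-++ as) ⟨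
  V X ℤ.- + List.length (as ++ bs) ∎
  where
  open ℤ.≤-Reasoning
  a = List.length as
  b = List.length bs
  eq : ∀ v a b → v ℤ.- b ℤ.- a ≡ v ℤ.- (a ℤ.+ b)
  eq = solve-∀

-- v - (2 + n) comes from claiming all 2 + n boxes, and 6 - n - v from leaving the last four.
StringBound : ℕ → ℤ → ℤ → Set
StringBound n v w = (v ℤ.- + (2 + n) ℤ.≤ w) ⊎ (2 ≤ n × + 6 ℤ.- + n ℤ.- v ℤ.≤ w)

stringBound-suc : ∀ {n v w} → StringBound n v w → StringBound (suc n) v (w ℤ.- + 1)
stringBound-suc {n} {v} {w} (inj₁ p)         = inj₁ (by-sum p (eq v w (+ (2 + n))))
  where
  eq : ∀ v w n → (w ℤ.- + 1) ℤ.- (v ℤ.- (+ 1 ℤ.+ n)) ≡ w ℤ.- (v ℤ.- n)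
  eq = solve-∀
stringBound-suc {n} {v} {w} (inj₂ (2≤n , p)) = inj₂ (ℕ.m≤n⇒m≤1+n 2≤n , by-sum p (eq v w (+ n)))
  where
  eq : ∀ v w n → (w ℤ.- + 1) ℤ.- (+ 6 ℤ.- (+ 1 ℤ.+ n) ℤ.- v) ≡ w ℤ.- (+ 6 ℤ.- n ℤ.- v)
  eq = solve-∀

length-∷ʳ : ∀ (as : List ℕ) x → List.length (as ++ x ∷ []) ≡ suc (List.length as)
length-∷ʳ as x = ≡.trans (length-++ as) (ℕ.+-comm _ 1)

-- Induction on the length, jointly with `cut-≥` for moves inside the string: each first move is no
-- better for the mover than one of the two strategies.
string-≥ : ∀ n zs {X} → List.length zs ≡ 2 + n → Unique zs → zs ♯ X → Captureless X →
           StringBound n (V X) (V (string zs ++ X))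
cut-≥    : ∀ n as s t bs {X} → let zs = as ++ s ∷ t ∷ bs
                                   R  = (string (as ++ s ∷ []) ++ string (t ∷ bs)) ++ X in
           List.length zs ≡ 2 + n → Unique zs → zs ♯ X → Captureless X →
           StringBound n (V X) (afterClaiming (gain (s ∷ t ∷ []) R) (V R))

string-≥ n []           ()
string-≥ n (_ ∷ [])     ()
string-≥ n zs@(x ∷ y ∷ _) {X} len u zs♯X captureless with bestMove (x ∷ y ∷ []) _ captureless
-- After a move in X the whole string is still on offer, now to the opponent; this is worse than
-- claiming it by twice its length.
... | outside {X′ = X′} p eq = inj₁ (by-sum₃ (captureless-≤ captureless p)
        (string-≤ zs (s≤s (s≤s z≤n)) u (♯-tail zs♯X p)) (ℤ.-≤+ {suc n} {2 + n})
        (≡.trans (cong (ℤ._- (V X ℤ.- + (2 + n))) eq)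
          (≡.trans (lin (V X) (V X′) (V (string zs ++ X′)) (+ (2 + n)))
            (cong (λ k → (ℤ.- V X′ ℤ.- V X) ℤ.+ (((V X′ ℤ.- + k) ℤ.- V (string zs ++ X′))
                          ℤ.+ (+ (2 + n) ℤ.- (ℤ.- + (2 + n))))) (sym len)))))
  where
  lin : ∀ v v′ w k → ℤ.- w ℤ.- (v ℤ.- k) ≡ (ℤ.- v′ ℤ.- v) ℤ.+ (((v′ ℤ.- k) ℤ.- w) ℤ.+ (k ℤ.- (ℤ.- k)))
  lin = solve-∀
... | inside {e} p eq with string-cut zs p
...   | as , bs , s , t , zs≡ , ≡-refl , q =
  subst (StringBound n (V X)) (sym (≡.trans eq (option-cong e (++⁺ʳ X q))))
    (cut-≥ n as s t bs (≡.trans (cong List.length (sym zs≡)) len) (subst Unique zs≡ u) (subst (_♯ X) zs≡ zs♯X) captureless)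

cut-≥ n [] s t [] {X} ≡-refl u zs♯X captureless =
  inj₁ (ℤ.≤-reflexive (sym (cong (λ k → afterClaiming k (V X)) (gain-all zs♯X))))
cut-≥ (suc n) [] s t bs@(_ ∷ _) {X} len (s∉ ∷ u) zs♯X captureless =
  subst (λ k → StringBound (suc n) (V X) (afterClaiming k (V (string (t ∷ bs) ++ X))))
    (sym (gain-1 refl (♯-string s∉ (zs♯X (here ≡-refl))) (here (here ≡-refl))))
    (stringBound-suc (string-≥ n (t ∷ bs) (ℕ.suc-injective len) u (zs♯X ∘ there) captureless))
cut-≥ zero    (_ ∷ [])     s t [] ()
cut-≥ zero    (_ ∷ _ ∷ [])     s t [] ()
cut-≥ zero    (_ ∷ _ ∷ _ ∷ _) s t [] ()
-- The mirror image of the previous case: the last box `t` is claimed, as `string (t ∷ [])` is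
-- empty.
cut-≥ (suc n) (a ∷ as) s t [] {X} len u zs♯X captureless =
  subst (λ S → StringBound (suc n) (V X) (afterClaiming (gain (s ∷ t ∷ []) (S ++ X)) (V (S ++ X))))
    (sym (++-identityʳ (string as⁺)))
    (subst (λ k → StringBound (suc n) (V X) (afterClaiming k (V (string as⁺ ++ X))))
      (sym (gain-1 (swap s t refl) t∉ (Any.++⁺ˡ (⊆-string as⁺ 2≤as⁺ (Any.++⁺ʳ (a ∷ as) (here ≡-refl))))))
      (stringBound-suc (string-≥ n as⁺ len⁺ (proj₁ split) (zs♯X′ ∘ Any.++⁺ˡ) captureless)))
  where
  as⁺ = a ∷ as ++ s ∷ []
  zs≡ = ++-assoc (a ∷ as) (s ∷ []) (t ∷ [])
  split = unique-++⁻ as⁺ (subst Unique (sym zs≡) u)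
  zs♯X′ : as⁺ ++ t ∷ [] ♯ X
  zs♯X′ = subst (_♯ X) (sym zs≡) zs♯X
  len⁺ : List.length as⁺ ≡ 2 + n
  len⁺ = ℕ.suc-injective (≡.trans (sym (≡.trans (cong List.length (sym zs≡)) (length-∷ʳ as⁺ t))) len)
  2≤as⁺ : 2 ≤ List.length as⁺
  2≤as⁺ = subst (2 ≤_) (sym len⁺) (s≤s (s≤s z≤n))
  t∉ : ¬ t On string as⁺ ++ X
  t∉ p with Any.++⁻ (string as⁺) p
  ... | inj₁ q = proj₂ (proj₂ split) (string-⊆ as⁺ q) (here ≡-refl)
  ... | inj₂ q = zs♯X′ (Any.++⁺ʳ as⁺ (here ≡-refl)) q
-- Nothing is claimed and the opponent can take all `2 + n` boxes, so the move is worth at least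
-- `2 + n - V X`. This exceeds `6 - n - V X` by `2 (n - 2)`, hence `2≤n` enters twice.
cut-≥ n (a ∷ as) s t (b ∷ bs) {X} len u zs♯X captureless =
  inj₂ (2≤n , subst (λ w → + 6 ℤ.- + n ℤ.- V X ℤ.≤ w) (sym R≡)
    (by-sum₃ R≤ (ℤ.+≤+ 2≤n) (ℤ.+≤+ 2≤n) (lin (V X) (V R) (+ n))))
  where
  as⁺ = a ∷ as ++ s ∷ []
  bs⁺ = t ∷ b ∷ bs
  R = (string as⁺ ++ string bs⁺) ++ X
  zs≡ = ++-assoc (a ∷ as) (s ∷ []) bs⁺
  2≤as⁺ : 2 ≤ List.length as⁺
  2≤as⁺ = subst (2 ≤_) (sym (length-∷ʳ (a ∷ as) s)) (s≤s (s≤s z≤n))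
  len⁺ : List.length (as⁺ ++ bs⁺) ≡ 2 + n
  len⁺ = ≡.trans (cong List.length zs≡) len
  2≤n : 2 ≤ n
  2≤n = ℕ.+-cancelˡ-≤ 2 2 n (subst (4 ≤_) (≡.trans (sym (length-++ as⁺)) len⁺)
          (ℕ.+-mono-≤ 2≤as⁺ (s≤s (s≤s z≤n))))
  R≡ : afterClaiming (gain (s ∷ t ∷ []) R) (V R) ≡ ℤ.- V R
  R≡ = cong (λ k → afterClaiming k (V R)) (gain-0 λ
    { (here ≡-refl) → Any.++⁺ˡ (Any.++⁺ˡ (⊆-string as⁺ 2≤as⁺ (Any.++⁺ʳ (a ∷ as) (here ≡-refl))))
    ; (there (here ≡-refl)) → Any.++⁺ˡ (Any.++⁺ʳ (string as⁺) (here (here ≡-refl))) })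
  R≤ : V R ℤ.≤ V X ℤ.- + (2 + n)
  R≤ = subst₂ (λ P k → V P ℤ.≤ V X ℤ.- + k) (sym (++-assoc (string as⁺) (string bs⁺) X)) len⁺
    (string²-≤ as⁺ bs⁺ 2≤as⁺ (s≤s (s≤s z≤n)) (subst Unique (sym zs≡) u) (subst (_♯ X) (sym zs≡) zs♯X))
  lin : ∀ v r n → ℤ.- r ℤ.- (+ 6 ℤ.- n ℤ.- v) ≡ ((v ℤ.- (+ 2 ℤ.+ n)) ℤ.- r) ℤ.+ ((n ℤ.- + 2) ℤ.+ (n ℤ.- + 2))
  lin = solve-∀

i≤∣i∣ : ∀ i → i ℤ.≤ + ℤ.∣ i ∣
i≤∣i∣ (+ n)        = ℤ.≤-refl
i≤∣i∣ ℤ.-[1+ n ]   = ℤ.-≤+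

-i≤∣i∣ : ∀ i → ℤ.- i ℤ.≤ + ℤ.∣ i ∣
-i≤∣i∣ i = subst (λ n → ℤ.- i ℤ.≤ + n) (ℤ.∣-i∣≡∣i∣ i) (i≤∣i∣ (ℤ.- i))

-- Claiming everything yields the mover `n + 4 - V X`, leaving the last four boxes yields
-- `n - 4 + V X`; the absolute value is the larger of the two.
string-value : ∀ n zs {X} → List.length zs ≡ 4 + n → Unique zs → zs ♯ X → Captureless X →
               V (string zs ++ X) ≡ ℤ.- (+ (n + ℤ.∣ V X ℤ.- + 4 ∣))
string-value n zs@(x ∷ y ∷ z ∷ w ∷ ws) {X} ≡-refl u zs♯X captureless = ℤ.≤-antisym upper lower
  where
  W = V (string zs ++ X)
  d = V X ℤ.- + 4
  upper : W ℤ.≤ ℤ.- (+ n ℤ.+ + ℤ.∣ d ∣)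
  upper with ℤ.+∣i∣≡i⊎+∣i∣≡-i d
  ... | inj₁ eq = ℤ.≤-trans (string-≤₂ x y z w ws u zs♯X)
          (ℤ.≤-reflexive (≡.trans (lin (V X) (+ n)) (cong (λ i → ℤ.- (+ n ℤ.+ i)) (sym eq))))
    where
    lin : ∀ v n → + 4 ℤ.- n ℤ.- v ≡ ℤ.- (n ℤ.+ (v ℤ.- + 4))
    lin = solve-∀
  ... | inj₂ eq = ℤ.≤-trans (string-≤ zs (s≤s (s≤s z≤n)) u zs♯X)
          (ℤ.≤-reflexive (≡.trans (lin (V X) (+ n)) (cong (λ i → ℤ.- (+ n ℤ.+ i)) (sym eq))))
    where
    lin : ∀ v n → v ℤ.- (+ 4 ℤ.+ n) ≡ ℤ.- (n ℤ.+ ℤ.- (v ℤ.- + 4))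
    lin = solve-∀
  lower : ℤ.- (+ n ℤ.+ + ℤ.∣ d ∣) ℤ.≤ W
  lower with string-≥ (2 + n) zs ≡-refl u zs♯X captureless
  ... | inj₁ p       = by-sum₂ p (-i≤∣i∣ d) (lin (V X) W (+ n) (+ ℤ.∣ d ∣))
    where
    lin : ∀ v w n a → w ℤ.- (ℤ.- (n ℤ.+ a)) ≡ (w ℤ.- (v ℤ.- (+ 4 ℤ.+ n))) ℤ.+ (a ℤ.- (ℤ.- (v ℤ.- + 4)))
    lin = solve-∀
  ... | inj₂ (_ , p) = by-sum₂ p (i≤∣i∣ d) (lin (V X) W (+ n) (+ ℤ.∣ d ∣))
    where
    lin : ∀ v w n a → w ℤ.- (ℤ.- (n ℤ.+ a)) ≡ (w ℤ.- (+ 6 ℤ.- (+ 2 ℤ.+ n) ℤ.- v)) ℤ.+ (a ℤ.- (v ℤ.- + 4))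
    lin = solve-∀

-- Opening a 3-chain

-- The order of the two boxes in `e` is left open because chains are read from both ends below.
isolated-pair : ∀ {e x y X} → e ↭ x ∷ y ∷ [] → x ∷ y ∷ [] ♯ X → V (e ∷ X) ≡ V X ℤ.- + 2
isolated-pair {[]}            p _   = contradiction (↭-sym p) ¬x∷xs↭[]
isolated-pair {_ ∷ _} {X = X} p xy♯X =
  ≡.trans (isolated (xy♯X ∘ Any-resp-↭ p)) (cong (λ n → V X ℤ.- + n) (↭-length p))

↭∷-∷⁻ : ∀ {A : Set} {e x : A} {xs R} → x ∷ xs ↭ e ∷ R →
        (e ≡ x × R ↭ xs) ⊎ (∃ λ xs′ → xs ↭ e ∷ xs′ × R ↭ x ∷ xs′)
↭∷-∷⁻ {x = x} p with ↭∷-++⁻ (x ∷ []) p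
... | inj₁ (S′ , q , r) with ≡-refl ← ↭-singleton-inv (↭-sym q) = inj₁ (≡-refl , r)
... | inj₂ q = inj₂ q

∉-∷ : ∀ {x l X} → ¬ x ∈ l → ¬ x On X → ¬ x On l ∷ X
∉-∷ x∉l x∉X (here x∈l)  = x∉l x∈l
∉-∷ x∉l x∉X (there x∈X) = x∉X x∈X

∉-pair : ∀ {x y z : ℕ} {e} → e ↭ y ∷ z ∷ [] → x ≢ y → x ≢ z → ¬ x ∈ e
∉-pair p x≢y x≢z x∈e with Any-resp-↭ p x∈e
... | here eq         = x≢y eq
... | there (here eq) = x≢z eq

∉-single : ∀ {x y : ℕ} → x ≢ y → ¬ x ∈ y ∷ []
∉-single x≢y (here eq) = x≢y eq

-∣∣≤ : ∀ i → ℤ.- + ℤ.∣ i ∣ ℤ.≤ i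
-∣∣≤ i = subst (ℤ.- + ℤ.∣ i ∣ ℤ.≤_) (ℤ.neg-involutive i) (ℤ.neg-mono-≤ (-i≤∣i∣ i))

≤-∣∣ : ∀ {w} i → w ℤ.≤ i → w ℤ.≤ ℤ.- i → w ℤ.≤ ℤ.- + ℤ.∣ i ∣
≤-∣∣ i w≤i w≤-i with ℤ.+∣i∣≡i⊎+∣i∣≡-i i
... | inj₁ eq = subst (λ j → _ ℤ.≤ ℤ.- j) (sym eq) w≤-i
... | inj₂ eq = subst (_ ℤ.≤_) (≡.trans (sym (ℤ.neg-involutive i)) (cong ℤ.-_ (sym eq))) w≤i

-- Refutes moves in X beside an opened chain: the opponent receives the same offer, so the value
-- `- w` after such a move is at least 0 and cannot undercut `- + n`.
neg-≤-neg : ∀ {w m n} → w ℤ.≤ ℤ.- + m → ℤ.- + n ℤ.≤ ℤ.- w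
neg-≤-neg {m = m} {n} w≤ = ℤ.≤-trans (ℤ.neg-≤-pos {n} {0})
  (ℤ.neg-mono-≤ (ℤ.≤-trans w≤ (ℤ.neg-≤-pos {m} {0})))

-- In what remains of a chain opened at one end, x and y (or x, y and z) are the boxes read from
-- the opened end, and the line bordering a single box is at the other end.
module _ {e : List ℕ} {x y : ℕ} (p : e ↭ x ∷ y ∷ []) (x≢y : x ≢ y) where

  private
    S : Pos
    S = e ∷ (y ∷ []) ∷ []

    y∈e : y ∈ e
    y∈e = Any-resp-↭ (↭-sym p) (there (here ≡-refl))

  take₂ : ∀ {X} → x ∷ y ∷ [] ♯ X → afterClaiming (gain e ((y ∷ []) ∷ X)) (V ((y ∷ []) ∷ X)) ≡ V X ℤ.- + 2
  take₂ {X} xy♯X = ≡.trans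
    (cong₂ afterClaiming (gain-1 p (∉-∷ (∉-single x≢y) (xy♯X (here ≡-refl))) (here (here ≡-refl)))
                         (isolated (xy♯X ∘ there)))
    (eq (V X))
    where
    eq : ∀ v → v ℤ.- + 1 ℤ.- + 1 ≡ v ℤ.- + 2
    eq = solve-∀

  -- The double-dealing move: once the far end line is drawn, the opponent claims both boxes with
  -- `e` and must then move in X.
  leave₂ : ∀ {X} → x ∷ y ∷ [] ♯ X → afterClaiming (gain (y ∷ []) (e ∷ X)) (V (e ∷ X)) ≡ ℤ.- (V X ℤ.- + 2)
  leave₂ xy♯X = cong₂ afterClaiming (gain-0 λ { (here ≡-refl) → here y∈e }) (isolated-pair p xy♯X)

  halfOpen₂-≤ : ∀ {X} → x ∷ y ∷ [] ♯ X → V (S ++ X) ℤ.≤ ℤ.- + ℤ.∣ V X ℤ.- + 2 ∣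
  halfOpen₂-≤ {X} xy♯X = ≤-∣∣ (V X ℤ.- + 2)
    (ℤ.≤-trans (V-≤ refl) (ℤ.≤-reflexive (take₂ xy♯X)))
    (ℤ.≤-trans (V-≤ (swap _ _ refl)) (ℤ.≤-reflexive (leave₂ xy♯X)))

  halfOpen₂ : ∀ {X} → x ∷ y ∷ [] ♯ X → Captureless X → V (S ++ X) ≡ ℤ.- + ℤ.∣ V X ℤ.- + 2 ∣
  halfOpen₂ {X} xy♯X captureless = ℤ.≤-antisym (halfOpen₂-≤ xy♯X) lower
    where
    d = V X ℤ.- + 2
    lower : ℤ.- + ℤ.∣ d ∣ ℤ.≤ V (S ++ X)
    lower with bestMove e ((y ∷ []) ∷ []) captureless
    ... | outside q eq = subst (_ ℤ.≤_) (sym eq) (neg-≤-neg (halfOpen₂-≤ (♯-tail xy♯X q)))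
    ... | inside q eq with ↭∷-∷⁻ q
    ...   | inj₁ (≡-refl , r) =
            subst (_ ℤ.≤_) (sym (≡.trans eq (≡.trans (option-cong e (++⁺ʳ X r)) (take₂ xy♯X)))) (-∣∣≤ d)
    ...   | inj₂ (_ , r , s) with ↭∷-∷⁻ r
    ...     | inj₂ (_ , t , _) = contradiction (↭-sym t) ¬x∷xs↭[]
    ...     | inj₁ (≡-refl , t) =
            subst (_ ℤ.≤_) (sym (≡.trans eq (≡.trans (option-cong (y ∷ []) (++⁺ʳ X (trans s (prep e t)))) (leave₂ xy♯X))))
              (ℤ.neg-mono-≤ (i≤∣i∣ d))

module _ {e₁ e₂ : List ℕ} {x y z : ℕ} (p₁ : e₁ ↭ x ∷ y ∷ []) (p₂ : e₂ ↭ y ∷ z ∷ [])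
         (x≢y : x ≢ y) (x≢z : x ≢ z) (y≢z : y ≢ z) where

  private
    S : Pos
    S = e₁ ∷ e₂ ∷ (z ∷ []) ∷ []

    y∈e₁ : y ∈ e₁
    y∈e₁ = Any-resp-↭ (↭-sym p₁) (there (here ≡-refl))

    y∈e₂ : y ∈ e₂
    y∈e₂ = Any-resp-↭ (↭-sym p₂) (here ≡-refl)

    z∈e₂ : z ∈ e₂
    z∈e₂ = Any-resp-↭ (↭-sym p₂) (there (here ≡-refl))

    x∉e₂ : ¬ x ∈ e₂
    x∉e₂ = ∉-pair p₂ x≢y x≢z

  gain₃ : ∀ {X} → x ∷ y ∷ z ∷ [] ♯ X → gain e₁ (e₂ ∷ (z ∷ []) ∷ X) ≡ 1
  gain₃ xyz♯X = gain-1 p₁ (∉-∷ x∉e₂ (∉-∷ (∉-single x≢z) (xyz♯X (here ≡-refl)))) (here y∈e₂)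

  halfOpen₃-≤ : ∀ {X} → x ∷ y ∷ z ∷ [] ♯ X → V (S ++ X) ℤ.≤ ℤ.- + (1 + ℤ.∣ V X ℤ.- + 2 ∣)
  halfOpen₃-≤ {X} xyz♯X = ℤ.≤-trans (V-≤-gain refl (gain₃ xyz♯X) ≡-refl)
    (ℤ.≤-trans (ℤ.+-monoˡ-≤ (ℤ.- + 1) (halfOpen₂-≤ p₂ y≢z (xyz♯X ∘ there)))
      (ℤ.≤-reflexive (eq (+ ℤ.∣ V X ℤ.- + 2 ∣))))
    where
    eq : ∀ a → ℤ.- a ℤ.- + 1 ≡ ℤ.- (+ 1 ℤ.+ a)
    eq = solve-∀

  -- Claiming `x` and going on as in `halfOpen₂` is best. Either other line of the chain claims
  -- nothing and lets the opponent take all three boxes (`split₂`, `split₃`).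
  halfOpen₃ : ∀ {X} → x ∷ y ∷ z ∷ [] ♯ X → Captureless X → V (S ++ X) ≡ ℤ.- + (1 + ℤ.∣ V X ℤ.- + 2 ∣)
  halfOpen₃ {X} xyz♯X captureless = ℤ.≤-antisym (halfOpen₃-≤ xyz♯X) lower
    where
    x∉X = xyz♯X (here ≡-refl)
    y∉X = xyz♯X (there (here ≡-refl))
    d   = V X ℤ.- + 2
    bound : ∀ {w} → w ℤ.≤ V X ℤ.- + 3 → ℤ.- + (1 + ℤ.∣ d ∣) ℤ.≤ ℤ.- w
    -- `- w` is at least `3 - V X`, that is `1 - d`, and `1 - ∣ d ∣` exceeds the goal by 2.
    bound {w} w≤ = by-sum₃ w≤ (i≤∣i∣ d) (ℤ.+≤+ {0} {2} z≤n) (eq (V X) w (+ ℤ.∣ d ∣))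
      where
      eq : ∀ v w a → ℤ.- w ℤ.- (ℤ.- (+ 1 ℤ.+ a)) ≡ (v ℤ.- + 3 ℤ.- w) ℤ.+ ((a ℤ.- (v ℤ.- + 2)) ℤ.+ (+ 2 ℤ.- + 0))
      eq = solve-∀
    split₂ : V (e₁ ∷ (z ∷ []) ∷ X) ℤ.≤ V X ℤ.- + 3
    split₂ = ℤ.≤-reflexive (≡.trans (isolated-pair p₁ xy♯) (≡.trans (cong (ℤ._- + 2) (isolated (xyz♯X ∘ there ∘ there)))
      (eq (V X))))
      where
      xy♯ : x ∷ y ∷ [] ♯ (z ∷ []) ∷ X
      xy♯ (here ≡-refl)         = ∉-∷ (∉-single x≢z) x∉X
      xy♯ (there (here ≡-refl)) = ∉-∷ (∉-single y≢z) y∉X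
      eq : ∀ v → v ℤ.- + 1 ℤ.- + 2 ≡ v ℤ.- + 3
      eq = solve-∀
    split₃ : V (e₁ ∷ e₂ ∷ X) ℤ.≤ V X ℤ.- + 3
    split₃ = ℤ.≤-trans
      (V-≤-gain refl (gain-1 p₁ (∉-∷ x∉e₂ x∉X) (here y∈e₂)) (isolated-pair p₂ (xyz♯X ∘ there)))
      (ℤ.≤-reflexive (eq (V X)))
      where
      eq : ∀ v → v ℤ.- + 2 ℤ.- + 1 ≡ v ℤ.- + 3
      eq = solve-∀
    lower : ℤ.- + (1 + ℤ.∣ d ∣) ℤ.≤ V (S ++ X)
    lower with bestMove e₁ (e₂ ∷ (z ∷ []) ∷ []) captureless
    ... | outside q eq = subst (_ ℤ.≤_) (sym eq) (neg-≤-neg (halfOpen₃-≤ (♯-tail xyz♯X q)))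
    ... | inside q eq with ↭∷-∷⁻ q
    ...   | inj₁ (≡-refl , r) = subst (_ ℤ.≤_)
            (sym (≡.trans eq (≡.trans (option-cong e₁ (++⁺ʳ X r))
              (cong₂ afterClaiming (gain₃ xyz♯X) (halfOpen₂ p₂ y≢z (xyz♯X ∘ there) captureless)))))
            (ℤ.≤-reflexive (lin (+ ℤ.∣ d ∣)))
      where
      lin : ∀ a → ℤ.- (+ 1 ℤ.+ a) ≡ ℤ.- a ℤ.- + 1
      lin = solve-∀
    ...   | inj₂ (_ , r , s) with ↭∷-∷⁻ r
    ...     | inj₁ (≡-refl , t) = subst (_ ℤ.≤_)
              (sym (≡.trans eq (≡.trans (option-cong e₂ (++⁺ʳ X (trans s (prep e₁ t))))
                (cong (λ k → afterClaiming k (V (e₁ ∷ (z ∷ []) ∷ X))) (gain-0 λ y∈ → on₂ (Any-resp-↭ p₂ y∈))))))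
              (bound split₂)
      where
      on₂ : ∀ {w} → w ∈ y ∷ z ∷ [] → w On e₁ ∷ (z ∷ []) ∷ X
      on₂ (here ≡-refl)         = here y∈e₁
      on₂ (there (here ≡-refl)) = there (here (here ≡-refl))
    ...     | inj₂ (_ , t , s′) with ↭∷-∷⁻ t
    ...       | inj₂ (_ , u , _) = contradiction (↭-sym u) ¬x∷xs↭[]
    ...       | inj₁ (≡-refl , u) = subst (_ ℤ.≤_)
                (sym (≡.trans eq (≡.trans (option-cong (z ∷ []) (++⁺ʳ X (trans s (prep e₁ (trans s′ (prep e₂ u))))))
                  (cong (λ k → afterClaiming k (V (e₁ ∷ e₂ ∷ X))) (gain-0 λ { (here ≡-refl) → there (here z∈e₂) })))))
                (bound split₃)

chain₃ : ℕ → ℕ → ℕ → Pos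
chain₃ x y z = (x ∷ []) ∷ (x ∷ y ∷ []) ∷ (y ∷ z ∷ []) ∷ (z ∷ []) ∷ []

-- For the last two lines the rest is listed from the far end, which makes them mirror images of the
-- first two.
data Chain₃Move (x y z : ℕ) : List ℕ → Pos → Set where
  firstEnd  : ∀ {S′} → S′ ↭ (x ∷ y ∷ []) ∷ (y ∷ z ∷ []) ∷ (z ∷ []) ∷ [] → Chain₃Move x y z (x ∷ []) S′
  firstLink : ∀ {S′} → S′ ↭ (x ∷ []) ∷ (y ∷ z ∷ []) ∷ (z ∷ []) ∷ [] → Chain₃Move x y z (x ∷ y ∷ []) S′
  lastLink  : ∀ {S′} → S′ ↭ (z ∷ []) ∷ (x ∷ y ∷ []) ∷ (x ∷ []) ∷ [] → Chain₃Move x y z (y ∷ z ∷ []) S′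
  lastEnd   : ∀ {S′} → S′ ↭ (y ∷ z ∷ []) ∷ (x ∷ y ∷ []) ∷ (x ∷ []) ∷ [] → Chain₃Move x y z (z ∷ []) S′

chain₃-move : ∀ {x y z e S′} → chain₃ x y z ↭ e ∷ S′ → Chain₃Move x y z e S′
chain₃-move p with ↭∷-∷⁻ p
... | inj₁ (≡-refl , r) = firstEnd r
... | inj₂ (_ , p , r) with ↭∷-∷⁻ p
...   | inj₁ (≡-refl , r′) = firstLink (trans r (prep _ r′))
...   | inj₂ (_ , p , r′) with ↭∷-∷⁻ p
...     | inj₁ (≡-refl , r″) = lastLink (trans r (trans (prep _ (trans r′ (prep _ r″)))
            (trans (prep _ (swap _ _ refl)) (trans (swap _ _ refl) (prep _ (swap _ _ refl))))))
...     | inj₂ (_ , p , r″) with ↭∷-∷⁻ p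
...       | inj₂ (_ , p , _) = contradiction (↭-sym p) ¬x∷xs↭[]
...       | inj₁ (≡-refl , r‴) = lastEnd (trans r (trans (prep _ (trans r′ (prep _ (trans r″ (prep _ r‴)))))
            (trans (prep _ (swap _ _ refl)) (trans (swap _ _ refl) (prep _ (swap _ _ refl))))))

chain₃-captureless : ∀ {x y z} → Captureless (chain₃ x y z)
chain₃-captureless p x∈ with chain₃-move p
chain₃-captureless p (here ≡-refl)         | firstEnd r  = Any-resp-↭ (↭-sym r) (here (here ≡-refl))
chain₃-captureless p (here ≡-refl)         | firstLink r = Any-resp-↭ (↭-sym r) (here (here ≡-refl))
chain₃-captureless p (there (here ≡-refl)) | firstLink r = Any-resp-↭ (↭-sym r) (there (here (here ≡-refl)))
chain₃-captureless p (here ≡-refl)         | lastLink r  = Any-resp-↭ (↭-sym r) (there (here (there (here ≡-refl))))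
chain₃-captureless p (there (here ≡-refl)) | lastLink r  = Any-resp-↭ (↭-sym r) (here (here ≡-refl))
chain₃-captureless p (here ≡-refl)         | lastEnd r   = Any-resp-↭ (↭-sym r) (here (there (here ≡-refl)))

-- An end line leaves three half-open boxes; an inner line leaves one box to be claimed at once and
-- two half-open ones. Both come to the same value.
chain₃-opened : ∀ {x y z e S′ X} → Unique (x ∷ y ∷ z ∷ []) → x ∷ y ∷ z ∷ [] ♯ X → Captureless X →
                chain₃ x y z ↭ e ∷ S′ → V (S′ ++ X) ≡ ℤ.- + (1 + ℤ.∣ V X ℤ.- + 2 ∣)
chain₃-opened {x} {y} {z} {X = X} ((x≢y ∷ x≢z ∷ []) ∷ (y≢z ∷ []) ∷ _) xyz♯X captureless p = opened (chain₃-move p)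
  where
  zyx♯X : z ∷ y ∷ x ∷ [] ♯ X
  zyx♯X = xyz♯X ∘ Any-resp-↭ (↭-reverse (x ∷ y ∷ z ∷ []))

  take : ∀ {a b c e} → e ↭ b ∷ c ∷ [] → a ≢ b → a ≢ c → b ≢ c → a ∷ b ∷ c ∷ [] ♯ X →
         V ((a ∷ []) ∷ e ∷ (c ∷ []) ∷ X) ≡ ℤ.- + (1 + ℤ.∣ V X ℤ.- + 2 ∣)
  take {a} {b} {c} {e} p a≢b a≢c b≢c abc♯X = ≡.trans
    (isolated λ { (here ≡-refl) → ∉-∷ (∉-pair p a≢b a≢c) (∉-∷ (∉-single a≢c) (abc♯X (here ≡-refl))) })
    (≡.trans (cong (ℤ._- + 1) (halfOpen₂ p b≢c (abc♯X ∘ there) captureless)) (eq (+ ℤ.∣ V X ℤ.- + 2 ∣)))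
    where
    eq : ∀ a → ℤ.- a ℤ.- + 1 ≡ ℤ.- (+ 1 ℤ.+ a)
    eq = solve-∀

  opened : ∀ {e S′} → Chain₃Move x y z e S′ → V (S′ ++ X) ≡ ℤ.- + (1 + ℤ.∣ V X ℤ.- + 2 ∣)
  opened (firstEnd r)  = ≡.trans (V-cong (++⁺ʳ X r)) (halfOpen₃ refl refl x≢y x≢z y≢z xyz♯X captureless)
  opened (firstLink r) = ≡.trans (V-cong (++⁺ʳ X r)) (take refl x≢y x≢z y≢z xyz♯X)
  opened (lastLink r)  = ≡.trans (V-cong (++⁺ʳ X r))
    (take (swap x y refl) (y≢z ∘ sym) (x≢z ∘ sym) (x≢y ∘ sym) zyx♯X)
  opened (lastEnd r)   = ≡.trans (V-cong (++⁺ʳ X r))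
    (halfOpen₃ (swap y z refl) (swap x y refl) (y≢z ∘ sym) (x≢z ∘ sym) (x≢y ∘ sym) zyx♯X captureless)

-- Opening a loop

-- A loop is encoded as a string that returns to its first box, so that `string-cut` also describes
-- moves in loops.
cycle : ℕ → List ℕ → Pos
cycle z zs = string (z ∷ zs ++ z ∷ [])

∈-∷∷ʳ : ∀ {x : ℕ} z zs → x ∈ z ∷ zs ++ z ∷ [] → x ∈ z ∷ zs
∈-∷∷ʳ z zs (here eq) = here eq
∈-∷∷ʳ z zs (there x∈) with Any.++⁻ zs x∈
... | inj₁ x∈zs      = there x∈zs
... | inj₂ (here eq) = here eq

-- The two parts of the cut cycle z ∷ zs ++ [ z ] are joined at z.
rejoin : ∀ {z zs} as s t bs → z ∷ zs ++ z ∷ [] ≡ as ++ s ∷ t ∷ bs →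
         ∃ λ ws → ws ↭ z ∷ zs × string (as ++ s ∷ []) ++ string (t ∷ bs) ↭ string ws
rejoin {z} {zs} []       s t bs eq with ≡-refl , eq′ ← ∷-injective eq =
  t ∷ bs , subst (_↭ z ∷ zs) eq′ (↭-sym (∷↭∷ʳ z zs)) , refl
rejoin {z} {zs} (a ∷ as) s t bs eq with ≡-refl , eq′ ← ∷-injective eq = join (t ∷ bs) (λ ()) eq′
  where
  -- `t ∷ bs` is generalised to a non-empty list so that its last entry, which is `z` again, can be
  -- split off.
  join : ∀ ds → ds ≢ [] → zs ++ z ∷ [] ≡ as ++ s ∷ ds →
         ∃ λ ws → ws ↭ z ∷ zs × string (z ∷ as ++ s ∷ []) ++ string ds ↭ string ws
  join ds ds≢[] eq with initLast ds
  ... | [] = contradiction ≡-refl ds≢[]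
  ... | cs ∷ʳ′ z′
    with ≡-refl , ≡-refl ← ∷ʳ-injective zs (as ++ s ∷ cs) (≡.trans eq (sym (++-assoc as (s ∷ cs) (z′ ∷ [])))) =
      cs ++ z ∷ as ++ s ∷ []
    , trans (shift z cs (as ++ s ∷ []))
        (prep z (trans (++-comm cs _) (↭-reflexive (++-assoc as (s ∷ []) cs))))
    , trans (++-comm (string (z ∷ as ++ s ∷ [])) _)
        (↭-reflexive (sym (string-++ cs z (as ++ s ∷ []))))

-- Whichever line is drawn, a single string through all boxes remains; hence the value in
-- `cycle-opened` does not depend on the line.
cycle-cut : ∀ {z zs e S′} → cycle z zs ↭ e ∷ S′ →
            (∀ {x} → x ∈ e → x ∈ z ∷ zs) × ∃ λ ws → ws ↭ z ∷ zs × S′ ↭ string ws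
cycle-cut {z} {zs} p with string-cut (z ∷ zs ++ z ∷ []) p
... | as , bs , s , t , zs≡ , ≡-refl , q with rejoin {z} {zs} as s t bs zs≡
...   | ws , r , j = e⊆ , ws , r , trans q j
  where
  e⊆ : ∀ {x} → x ∈ s ∷ t ∷ [] → x ∈ z ∷ zs
  e⊆ x∈ = ∈-∷∷ʳ z zs (subst (_ ∈_) (sym zs≡) (Any.++⁺ʳ as (Any.++⁺ˡ {ys = bs} x∈)))

cycle-captureless : ∀ {z zs} → 1 ≤ List.length zs → Captureless (cycle z zs)
cycle-captureless 1≤zs p x∈ with e⊆ , ws , q , r ← cycle-cut p =
  Any-resp-↭ (↭-sym r) (⊆-string ws (subst (2 ≤_) (sym (↭-length q)) (s≤s 1≤zs)) (Any-resp-↭ (↭-sym q) (e⊆ x∈)))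

cycle-opened : ∀ {n z zs e S′ X} → List.length (z ∷ zs) ≡ 4 + n → Unique (z ∷ zs) → z ∷ zs ♯ X → Captureless X →
               cycle z zs ↭ e ∷ S′ → V (S′ ++ X) ≡ ℤ.- + (n + ℤ.∣ V X ℤ.- + 4 ∣)
cycle-opened {n} {X = X} len u zs♯X captureless p with _ , ws , q , r ← cycle-cut p =
  ≡.trans (V-cong (++⁺ʳ X r))
    (string-value n ws (≡.trans (↭-length q) len) (Unique-resp-↭ (↭⇒↭ₛ (↭-sym q)) u) (zs♯X ∘ Any-resp-↭ q) captureless)

-- Endgames

infix 4 _##_

_##_ : Pos → Pos → Set
P ## Q = ∀ {x} → x On P → ¬ x On Q

##-resp : ∀ {P P′ Q Q′} → (∀ {x} → x On P′ → x On P) → (∀ {x} → x On Q′ → x On Q) → P ## Q → P′ ## Q′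
##-resp P′⊆P Q′⊆Q P##Q x∈P′ x∈Q′ = P##Q (P′⊆P x∈P′) (Q′⊆Q x∈Q′)

-- The index is the pair (a , c) for which opening the component costs a + ∣ w - c ∣ when the rest is worth w.
data Component : Pos → ℕ × ℕ → Set where
  isCycle  : ∀ {n z zs} → List.length (z ∷ zs) ≡ 4 + n → Unique (z ∷ zs) → Component (cycle z zs) (n , 4)
  isChain₃ : ∀ {x y z} → Unique (x ∷ y ∷ z ∷ []) → Component (chain₃ x y z) (1 , 2)

component-captureless : ∀ {S c} → Component S c → Captureless S
component-captureless (isCycle {zs = _ ∷ _} _ _) = cycle-captureless (s≤s z≤n)
component-captureless (isChain₃ _)               = chain₃-captureless

component-nonempty : ∀ {S c} → Component S c → ∃₂ λ s S′ → S ≡ s ∷ S′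
component-nonempty (isCycle {zs = _ ∷ _} _ _) = _ , _ , ≡-refl
component-nonempty (isChain₃ _)               = _ , _ , ≡-refl

component-opened : ∀ {S a c X e S′} → Component S (a , c) → S ## X → Captureless X → S ↭ e ∷ S′ →
                   V (S′ ++ X) ≡ ℤ.- + (a + ℤ.∣ V X ℤ.- + c ∣)
component-opened (isCycle {z = z} {zs} len u) S##X = cycle-opened len u
  (S##X ∘ ⊆-string (z ∷ zs ++ z ∷ []) 2≤ ∘ Any.++⁺ˡ)
  where
  2≤ : 2 ≤ List.length (z ∷ zs ++ z ∷ [])
  2≤ = subst (2 ≤_) (sym (length-∷ʳ (z ∷ zs) z)) (s≤s (s≤s z≤n))
component-opened (isChain₃ {x} {y} {z} u) S##X = chain₃-opened u (S##X ∘ on)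
  where
  on : ∀ {w} → w ∈ x ∷ y ∷ z ∷ [] → w On chain₃ x y z
  on (here ≡-refl)                 = here (here ≡-refl)
  on (there (here ≡-refl))         = there (there (here (here ≡-refl)))
  on (there (there (here ≡-refl))) = there (there (there (here (here ≡-refl))))

opening : ℕ × ℕ → ℤ → ℤ
opening (a , c) w = + (a + ℤ.∣ w ℤ.- + c ∣)

component-option : ∀ {S c X e S′} → Component S c → S ## X → Captureless X → S ↭ e ∷ S′ →
                   afterClaiming (gain e (S′ ++ X)) (V (S′ ++ X)) ≡ opening c (V X)
component-option S-comp S##X captureless p = ≡.trans
  (cong₂ afterClaiming (gain-0 (Any.++⁺ˡ ∘ component-captureless S-comp p)) (component-opened S-comp S##X captureless p))
  (ℤ.neg-involutive _)

-- Moves are now whole components. Their cost depends on the rest only through its value, so the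
-- remaining list is ignored.
private module Openings = Minimax (λ c _ → opening c)

opaque

  val : List (ℕ × ℕ) → ℤ
  val = Openings.best

  val-[] : val [] ≡ 0ℤ
  val-[] = ≡-refl

  val-cong : ∀ {cs ds} → cs ↭ ds → val cs ≡ val ds
  val-cong = Openings.best-cong (λ _ _ _ → ≡-refl)

  val-≤ : ∀ {cs d ds} → cs ↭ d ∷ ds → val cs ℤ.≤ opening d (val ds)
  val-≤ = Openings.best-≤ (λ _ _ _ → ≡-refl)

  val-attained : ∀ c cs → ∃₂ λ d ds → c ∷ cs ↭ d ∷ ds × val (c ∷ cs) ≡ opening d (val ds)
  val-attained = Openings.best-attained (λ _ _ _ → ≡-refl)

data Endgame : List (ℕ × ℕ) → Pos → Set where
  []  : Endgame [] []
  add : ∀ {S c cs X} → Component S c → S ## X → Endgame cs X → Endgame (c ∷ cs) (S ++ X)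

endgame-captureless : ∀ {cs P} → Endgame cs P → Captureless P
endgame-captureless []                  p = contradiction (↭-sym p) ¬x∷xs↭[]
endgame-captureless (add S-comp _ rest)   =
  captureless-++ (component-captureless S-comp) (endgame-captureless rest)

-- Brings a chosen component to the front, where `endgame-value` can open it.
endgame-↭ : ∀ {cs ds P} → Endgame cs P → cs ↭ ds → ∃ λ Q → P ↭ Q × Endgame ds Q
endgame-↭ G                       refl        = _ , refl , G
endgame-↭ (add {S} S-comp S##X G) (prep _ p) with Q , X↭Q , H ← endgame-↭ G p =
  S ++ Q , ++⁺ˡ S X↭Q , add S-comp (##-resp id (Any-resp-↭ (↭-sym X↭Q)) S##X) H
endgame-↭ (add {S} S-comp S##TX (add {T} T-comp T##X G)) (swap _ _ p) with Q , X↭Q , H ← endgame-↭ G p =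
    T ++ S ++ Q
  , trans (shifts S T) (++⁺ˡ T (++⁺ˡ S X↭Q))
  , add T-comp
      (λ x∈T x∈SQ → [ (λ x∈S → S##TX x∈S (Any.++⁺ˡ x∈T)) , T##X x∈T ∘ Any-resp-↭ (↭-sym X↭Q) ]′ (Any.++⁻ S x∈SQ))
      (add S-comp (##-resp id (Any.++⁺ʳ T ∘ Any-resp-↭ (↭-sym X↭Q)) S##TX) H)
endgame-↭ G (trans p q) with _ , P↭Q , H ← endgame-↭ G p with _ , Q↭R , I ← endgame-↭ H q = _ , trans P↭Q Q↭R , I

record Opened (cs : List (ℕ × ℕ)) (e : List ℕ) (R : Pos) : Set where
  constructor opened
  field
    {component} : ℕ × ℕ
    {others}    : List (ℕ × ℕ)
    {S S′ X}    : Pos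
    cs↭         : cs ↭ component ∷ others
    S↭          : S ↭ e ∷ S′
    R↭          : R ↭ S′ ++ X
    S-component : Component S component
    S##X        : S ## X
    rest        : Endgame others X

endgame-move : ∀ {cs P e R} → Endgame cs P → P ↭ e ∷ R → Opened cs e R
endgame-move [] p = contradiction (↭-sym p) ¬x∷xs↭[]
endgame-move (add {S} {c} S-comp S##X G) p with ↭∷-++⁻ S p
... | inj₁ (S′ , q , r) = opened refl q r S-comp S##X G
... | inj₂ (X′ , q , r) with endgame-move G q
...   | opened {S = T} {T′} {Y} cs↭ T↭ X′↭ T-comp T##Y H = opened
        (trans (prep c cs↭) (swap _ _ refl)) T↭ (trans r (trans (++⁺ˡ S X′↭) (shifts S T′))) T-comp
        (λ x∈T x∈SY → [ (λ x∈S → S##X x∈S (on-X (Any.++⁺ˡ x∈T))) , T##Y x∈T ]′ (Any.++⁻ S x∈SY))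
        (add S-comp (##-resp id (on-X ∘ Any.++⁺ʳ T) S##X) H)
  where
  on-X : ∀ {x} → x On T ++ Y → x On _
  on-X = Any-resp-↭ (↭-sym (trans q (trans (prep _ X′↭) (++⁺ʳ Y (↭-sym T↭)))))

-- Every line lies in one component, and all lines of a component cost the same. So `lower` sorts
-- the best line into its component and `upper` realises the best opening by the first line of its
-- component. The induction is on the number of components, as any of them may be the one opened.
endgame-value : ∀ n {cs P} → List.length cs ≡ n → Endgame cs P → V P ≡ val cs
endgame-value zero    _   []                          = ≡.trans V-[] (sym val-[])
endgame-value (suc n) {c ∷ cs} {P} len G@(add {X = X} S-comp S##X _)
  with s , S′ , ≡-refl ← component-nonempty S-comp = ℤ.≤-antisym upper lower
  where
  ih : ∀ {d ds Q} → c ∷ cs ↭ d ∷ ds → Endgame ds Q → V Q ≡ val ds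
  ih p = endgame-value n (ℕ.suc-injective (≡.trans (sym (↭-length p)) len))

  lower : val (c ∷ cs) ℤ.≤ V P
  lower with e , R , p , eq ← V-attained s (S′ ++ X)
    with opened {d} {ds} {S′ = U} {Y} cs↭ S↭ R↭ T-comp T##Y H ← endgame-move G p = begin
      val (c ∷ cs)              ≤⟨ val-≤ cs↭ ⟩
      opening d (val ds)        ≡⟨ cong (opening d) (ih cs↭ H) ⟨
      opening d (V Y)           ≡⟨ component-option T-comp T##Y (endgame-captureless H) S↭ ⟨
      afterClaiming (gain e (U ++ Y)) (V (U ++ Y))
                                ≡⟨ option-cong e R↭ ⟨
      afterClaiming (gain e R) (V R)
                                ≡⟨ eq ⟨
      V P                       ∎
    where open ℤ.≤-Reasoning

  upper : V P ℤ.≤ val (c ∷ cs)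
  upper with d , ds , p , eq ← val-attained c cs
    with _ , P↭ , add {T} {X = Y} T-comp T##Y H ← endgame-↭ G p
    with t , T′ , ≡-refl ← component-nonempty T-comp = begin
      V P                       ≤⟨ V-≤ P↭ ⟩
      afterClaiming (gain t (T′ ++ Y)) (V (T′ ++ Y))
        ≡⟨ component-option T-comp T##Y (endgame-captureless H) refl ⟩
      opening d (V Y)           ≡⟨ cong (opening d) (ih p H) ⟩
      opening d (val ds)        ≡⟨ eq ⟨
      val (c ∷ cs)              ∎
    where open ℤ.≤-Reasoning

-- Disjoint unions, loops and the 3-chain as endgames

endgame-++ : ∀ {cs ds P Q} → Endgame cs P → Endgame ds Q → P ## Q → Endgame (cs ++ ds) (P ++ Q)
endgame-++ []                                H _    = H
endgame-++ {ds = ds} {Q = Q} (add {S} {c} {cs} {X} S-comp S##X G) H P##Q =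
  subst (Endgame (c ∷ cs ++ ds)) (sym (++-assoc S X Q))
    (add S-comp (λ x∈S x∈XQ → [ S##X x∈S , P##Q (Any.++⁺ˡ x∈S) ]′ (Any.++⁻ X x∈XQ))
      (endgame-++ G H (P##Q ∘ Any.++⁺ʳ S)))

shiftBoxes : ℕ → Pos → Pos
shiftBoxes b = List.map (List.map (_+_ b))

on-shift⁻ : ∀ b P {x} → x On shiftBoxes b P → ∃ λ y → x ≡ b + y × y On P
on-shift⁻ b (e ∷ P) (here x∈) with y , y∈ , eq ← ∈-map⁻ (_+_ b) x∈ = y , eq , here y∈
on-shift⁻ b (e ∷ P) (there x∈) with y , eq , y∈ ← on-shift⁻ b P x∈ = y , eq , there y∈

shift-string : ∀ b zs → shiftBoxes b (string zs) ≡ string (List.map (_+_ b) zs)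
shift-string b []           = ≡-refl
shift-string b (_ ∷ [])     = ≡-refl
shift-string b (_ ∷ y ∷ zs) = cong (_ ∷_) (shift-string b (y ∷ zs))

component-shift : ∀ b {S c} → Component S c → Component (shiftBoxes b S) c
component-shift b (isCycle {n} {z} {zs} len u) = subst (λ S → Component S (n , 4))
  (sym (≡.trans (shift-string b (z ∷ zs ++ z ∷ [])) (cong (λ ws → string (b + z ∷ ws)) (map-++ (_+_ b) zs (z ∷ [])))))
  (isCycle (≡.trans (length-map (_+_ b) (z ∷ zs)) len) (map⁺ (ℕ.+-cancelˡ-≡ b _ _) u))
component-shift b (isChain₃ u) = isChain₃ (map⁺ (ℕ.+-cancelˡ-≡ b _ _) u)

##-shift : ∀ b {P Q} → P ## Q → shiftBoxes b P ## shiftBoxes b Q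
##-shift b {P} {Q} P##Q x∈P x∈Q with on-shift⁻ b P x∈P | on-shift⁻ b Q x∈Q
... | y , ≡-refl , y∈P | z , eq , z∈Q = P##Q y∈P (subst (_On Q) (sym (ℕ.+-cancelˡ-≡ b _ _ eq)) z∈Q)

endgame-shift : ∀ b {cs P} → Endgame cs P → Endgame cs (shiftBoxes b P)
endgame-shift b []                              = []
endgame-shift b (add {S} {c} {cs} {X} S-comp S##X G) = subst (Endgame (c ∷ cs)) (sym (map-++ _ S X))
  (add (component-shift b S-comp) (##-shift b S##X) (endgame-shift b G))

labels-relabel : ∀ {b c} (f : Fin b → Fin c) (inj : ∀ i j → f i ≡ f j → i ≡ j) (g : ℕ → ℕ) →
                 (∀ i → toℕ (f i) ≡ g (toℕ i)) → ∀ e → labels (relabel f inj e) ≡ List.map g (labels e)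
labels-relabel f inj g eq (edge x)        = cong (_∷ []) (eq x)
labels-relabel f inj g eq (between x y _) = cong₂ (λ i j → i ∷ j ∷ []) (eq x) (eq y)

hyper-relabel : ∀ {b c l} (f : Fin b → Fin c) (inj : ∀ i j → f i ≡ f j → i ≡ j) (g : ℕ → ℕ) →
                (∀ i → toℕ (f i) ≡ g (toℕ i)) → ∀ (P : Position b l) →
                hyper (Vec.map (relabel f inj) P) ≡ List.map (List.map g) (hyper P)
hyper-relabel f inj g eq []      = ≡-refl
hyper-relabel f inj g eq (e ∷ P) = cong₂ _∷_ (labels-relabel f inj g eq e) (hyper-relabel f inj g eq P)

hyper-⊎ₚ : ∀ {b c k l} (P : Position b k) (Q : Position c l) →
           hyper (P ⊎ₚ Q) ≡ hyper P ++ shiftBoxes b (hyper Q)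
hyper-⊎ₚ {b} {c} P Q = begin
  hyper (P ⊎ₚ Q)                          ≡⟨ cong toList (Vec.map-++ labels P′ Q′) ⟩
  toList (Vec.map labels P′ Vec.++ Vec.map labels Q′) ≡⟨ Vec.toList-++ (Vec.map labels P′) _ ⟩
  hyper P′ ++ hyper Q′
    ≡⟨ cong₂ List._++_ (hyper-relabel _ _ id (λ i → Fin.toℕ-↑ˡ i c) P) (hyper-relabel _ _ (_+_ b) (Fin.toℕ-↑ʳ b) Q) ⟩
  List.map (List.map id) (hyper P) ++ shiftBoxes b (hyper Q)
    ≡⟨ cong (List._++ _) (≡.trans (map-cong map-id (hyper P)) (map-id (hyper P))) ⟩
  hyper P ++ shiftBoxes b (hyper Q)  ∎
  where
  open ≡-Reasoning
  P′ = Vec.map (relabel (Fin._↑ˡ c) (Fin.↑ˡ-injective c)) P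
  Q′ = Vec.map (relabel (b Fin.↑ʳ_) (Fin.↑ʳ-injective b)) Q

on-hyper-< : ∀ {b l} (P : Position b l) {x} → x On hyper P → x < b
on-hyper-< (e ∷ P) (here x∈) with i , _ , eq ← ∈-map⁻ toℕ x∈ = subst (_< _) (sym eq) (Fin.toℕ<n i)
on-hyper-< (e ∷ P) (there x∈) = on-hyper-< P x∈

hyper-##-shift : ∀ {b l} (P : Position b l) Q → hyper P ## shiftBoxes b Q
hyper-##-shift {b} P Q x∈P x∈Q with y , ≡-refl , _ ← on-shift⁻ b Q x∈Q =
  ℕ.<⇒≱ (on-hyper-< P x∈P) (ℕ.m≤m+n b y)

endgame-⊕ : ∀ {cs ds} G H → Endgame cs (hyper (lines G)) → Endgame ds (hyper (lines H)) →
            Endgame (cs ++ ds) (hyper (lines (G ⊕ H)))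
endgame-⊕ G H E F = subst (Endgame _) (sym (hyper-⊎ₚ (lines G) (lines H)))
  (endgame-++ E (endgame-shift (#boxes G) F) (hyper-##-shift (lines G) _))

hyper-path : ∀ k → hyper (path k) ≡ string (upTo (suc k))
hyper-path k = ≡.trans (cong toList (≡.trans (sym (Vec.tabulate-∘ labels link)) (Vec.tabulate-cong label-link)))
                       (links id k)
  where
  label-link : ∀ {k} (i : Fin k) → labels (link i) ≡ toℕ i ∷ suc (toℕ i) ∷ []
  label-link i = cong (λ j → j ∷ suc (toℕ i) ∷ []) (Fin.toℕ-inject₁ i)
  -- Generalised over the naming `f` of the boxes, since the remaining path starts at `f 1`.
  links : ∀ (f : ℕ → ℕ) k → toList (tabulate {n = k} λ i → f (toℕ i) ∷ f (suc (toℕ i)) ∷ []) ≡ string (applyUpTo f (suc k))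
  links f zero    = ≡-refl
  links f (suc k) = cong (_ ∷_) (links (f ∘ suc) k)

hyper-loop : ∀ k → hyper (loopLines k) ≡ cycle 0 (applyUpTo suc (suc k))
hyper-loop k = begin
  hyper (loopLines k)             ≡⟨ cong toList (Vec.map-∷ʳ labels closing (path (suc k))) ⟩
  toList (Vec.map labels (path (suc k)) Vec.∷ʳ labels closing)
                                  ≡⟨ Vec.toList-∷ʳ (labels closing) (Vec.map labels (path (suc k))) ⟩
  hyper (path (suc k)) ++ labels closing ∷ []
    ≡⟨ cong₂ (λ P x → P ++ (x ∷ 0 ∷ []) ∷ []) (hyper-path (suc k)) (Fin.toℕ-fromℕ (suc k)) ⟩
  string (upTo (2 + k)) ++ (suc k ∷ 0 ∷ []) ∷ []
    ≡⟨ cong (λ zs → string zs ++ (suc k ∷ 0 ∷ []) ∷ []) (upTo-∷ʳ (suc k)) ⟨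
  string (upTo (suc k) ++ suc k ∷ []) ++ string (suc k ∷ 0 ∷ [])
    ≡⟨ string-++ (upTo (suc k)) (suc k) (0 ∷ []) ⟨
  string (upTo (suc k) ++ suc k ∷ 0 ∷ [])
    ≡⟨ cong string (++-assoc (upTo (suc k)) (suc k ∷ []) (0 ∷ [])) ⟨
  string ((upTo (suc k) ++ suc k ∷ []) ++ 0 ∷ [])
    ≡⟨ cong (λ zs → string (zs ++ 0 ∷ [])) (upTo-∷ʳ (suc k)) ⟩
  cycle 0 (applyUpTo suc (suc k)) ∎
  where
  open ≡-Reasoning
  closing : Line (2 + k)
  closing = between (Fin.fromℕ (suc k)) zero (λ ())

loop-component : ∀ n (4≤n : 4 ≤ n) → Component (hyper (lines (loop n 4≤n))) (n ∸ 4 , 4)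
loop-component 1 (s≤s ())
loop-component 2 (s≤s (s≤s ()))
loop-component 3 (s≤s (s≤s (s≤s ())))
loop-component (suc (suc (suc (suc n)))) 4≤n = subst (λ S → Component S (n , 4)) (sym (hyper-loop (2 + n)))
  (isCycle {n} {0} {applyUpTo suc (3 + n)} (length-applyUpTo id (4 + n)) (upTo⁺ (4 + n)))

chain-component : Component (hyper (lines (chain 3))) (1 , 2)
chain-component = isChain₃ (upTo⁺ 3)

endgame-single : ∀ {S c} → Component S c → Endgame (c ∷ []) S
endgame-single {S} {c} S-comp = subst (Endgame (c ∷ [])) (++-identityʳ S) (add S-comp (λ _ ()) [])

type : EvenLoop → ℕ × ℕ
type L = length L ∸ 4 , 4

loops-endgame : ∀ Ls → Endgame (List.map type Ls) (hyper (lines (loops Ls)))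
loops-endgame []       = []
loops-endgame (L ∷ Ls) =
  endgame-⊕ (evenLoop L) (loops Ls) (endgame-single (loop-component (length L) (4≤ L))) (loops-endgame Ls)

moveValue≡opening : ∀ {b l c cs S X} (P : Position b l) m → hyper P ↭ S ++ X → labels (lookup P m) ∈ S →
                    Component S c → S ## X → Endgame cs X → moveValue P m ≡ opening c (val cs)
moveValue≡opening {c = c} {S = S} {X} P m P↭ m∈ S-comp S##X G
  with R , p , eq ← moveValue≡after P m
  with S′ , S↭ ← ∈⇒↭∷ m∈ = ≡.trans eq (≡.trans
    (option-cong (labels (lookup P m)) (drop-∷ (trans (↭-sym p) (trans P↭ (++⁺ʳ X S↭)))))
    (≡.trans (component-option S-comp S##X (endgame-captureless G) S↭) (cong (opening c) (endgame-value _ ≡-refl G))))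

value≡val : ∀ {cs b l} {P : Position b l} → Endgame cs (hyper P) → value P ≡ val cs
value≡val {P = P} G = ≡.trans (value≡V P) (endgame-value _ ≡-refl G)

lookup-∈-hyper : ∀ {b l} (P : Position b l) m → labels (lookup P m) ∈ hyper P
lookup-∈-hyper P m = subst (_∈ hyper P) (Vec.lookup-map m labels P) (∈-toList⁺ (∈-lookup m (Vec.map labels P)))

lookup-inʳ : ∀ G H m → labels (lookup (lines (G ⊕ H)) (inʳ G H m)) ∈ shiftBoxes (#boxes G) (hyper (lines H))
lookup-inʳ G H m = subst (_∈ _) (sym eq) (∈-map⁺ (List.map (_+_ (#boxes G))) (lookup-∈-hyper (lines H) m))
  where
  rel = relabel (#boxes G Fin.↑ʳ_) (Fin.↑ʳ-injective (#boxes G))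
  eq : labels (lookup (lines (G ⊕ H)) (inʳ G H m)) ≡ List.map (_+_ (#boxes G)) (labels (lookup (lines H) m))
  eq = ≡.trans (cong labels (≡.trans (Vec.lookup-++ʳ (Vec.map _ (lines G)) _ m) (Vec.lookup-map m rel (lines H))))
         (labels-relabel _ _ (_+_ (#boxes G)) (Fin.toℕ-↑ʳ (#boxes G)) (lookup (lines H) m))

lookup-inˡ : ∀ G H m → labels (lookup (lines (G ⊕ H)) (inˡ G H m)) ≡ labels (lookup (lines G) m)
lookup-inˡ G H m = ≡.trans
  (cong labels (≡.trans (Vec.lookup-++ˡ (Vec.map _ (lines G)) _ m) (Vec.lookup-map m _ (lines G))))
  (≡.trans (labels-relabel _ _ id (λ i → Fin.toℕ-↑ˡ i (#boxes H)) (lookup (lines G) m)) (map-id _))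

-- Comparing the openings

-- An opening costs a natural number and the empty endgame is worth 0, so no value is negative
-- (`val≡+size`) and the comparison can be made in ℕ.
size : List (ℕ × ℕ) → ℕ
size cs = ℤ.∣ val cs ∣

cost : ℕ × ℕ → ℕ → ℕ
cost (a , c) w = a + ∣ w - c ∣

∣⊖∣≡∣-∣ : ∀ m n → ℤ.∣ m ℤ.⊖ n ∣ ≡ ∣ m - n ∣
∣⊖∣≡∣-∣ zero    zero    = ≡-refl
∣⊖∣≡∣-∣ zero    (suc n) = ≡-refl
∣⊖∣≡∣-∣ (suc m) zero    = ≡-refl
∣⊖∣≡∣-∣ (suc m) (suc n) = ≡.trans (cong ℤ.∣_∣ (ℤ.[1+m]⊖[1+n]≡m⊖n m n)) (∣⊖∣≡∣-∣ m n)

opening≡cost : ∀ d w → opening d (+ w) ≡ + cost d w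
opening≡cost (a , c) w = cong (λ k → + (a + k)) (≡.trans (cong ℤ.∣_∣ (ℤ.m-n≡m⊖n w c)) (∣⊖∣≡∣-∣ w c))

val≡+size : ∀ cs → val cs ≡ + size cs
val≡+size []       rewrite val-[] = ≡-refl
val≡+size (c ∷ cs) with d , ds , _ , eq ← val-attained c cs rewrite eq = ≡-refl

opening-val : ∀ d cs → opening d (val cs) ≡ + cost d (size cs)
opening-val d cs = ≡.trans (cong (opening d) (val≡+size cs)) (opening≡cost d (size cs))

size-cong : ∀ {cs ds} → cs ↭ ds → size cs ≡ size ds
size-cong p = cong ℤ.∣_∣ (val-cong p)

size-≤ : ∀ {cs d ds} → cs ↭ d ∷ ds → size cs ≤ cost d (size ds)
size-≤ {cs} {d} {ds} p = ℤ.drop‿+≤+ (subst₂ ℤ._≤_ (val≡+size cs) (opening-val d ds) (val-≤ p))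

size-attained : ∀ c cs → ∃₂ λ d ds → c ∷ cs ↭ d ∷ ds × size (c ∷ cs) ≡ cost d (size ds)
size-attained c cs with d , ds , p , eq ← val-attained c cs =
  d , ds , p , cong ℤ.∣_∣ (≡.trans eq (opening-val d ds))

∣-∣-≤ : ∀ {x y δ} c → x ≤ δ + y → y ≤ δ + x → ∣ x - c ∣ ≤ δ + ∣ y - c ∣
∣-∣-≤ {x} {y} {δ} c x≤ y≤ = ℕ.≤-trans (ℕ.∣-∣-triangle x y c) (ℕ.+-monoˡ-≤ ∣ y - c ∣ ∣x-y∣≤δ)
  where
  ∣x-y∣≤δ : ∣ x - y ∣ ≤ δ
  ∣x-y∣≤δ with ℕ.∣m-n∣≡[m∸n]∨[n∸m] x y
  ... | inj₁ eq = subst (_≤ δ) (sym eq) (ℕ.m≤n+o⇒m∸n≤o x y (subst (x ≤_) (ℕ.+-comm δ y) x≤))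
  ... | inj₂ eq = subst (_≤ δ) (sym eq) (ℕ.m≤n+o⇒m∸n≤o y x (subst (y ≤_) (ℕ.+-comm δ x) y≤))

-- Copy the best opening of the endgame with `b`. If it is the altered component, the rests agree;
-- otherwise they differ by at most `δ` by induction, and `∣ w - c′ ∣` changes no more than `w`
-- does. As this distance may vary either way, both inequalities between `a` and `b` are carried
-- along.
size-lipschitz : ∀ k {a b δ c} cs → List.length cs ≡ k → a ≤ δ + b → b ≤ δ + a →
                 size ((a , c) ∷ cs) ≤ δ + size ((b , c) ∷ cs)
size-lipschitz k {a} {b} {δ} {c} cs len a≤ b≤ with size-attained (b , c) cs
... | d , ds , p , eq with ↭∷-∷⁻ p
...   | inj₁ (≡-refl , q) = begin
  size ((a , c) ∷ cs)             ≤⟨ size-≤ refl ⟩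
  a + ∣ size cs - c ∣             ≤⟨ ℕ.+-monoˡ-≤ _ a≤ ⟩
  δ + b + ∣ size cs - c ∣         ≡⟨ ℕ.+-assoc δ b _ ⟩
  δ + (b + ∣ size cs - c ∣)       ≡⟨ cong (λ w → δ + (b + ∣ w - c ∣)) (size-cong q) ⟨
  δ + (b + ∣ size ds - c ∣)       ≡⟨ cong (_+_ δ) eq ⟨
  δ + size ((b , c) ∷ cs)         ∎
  where open ℕ.≤-Reasoning
size-lipschitz zero    cs len a≤ b≤ | d , ds , p , eq | inj₂ (cs′ , q , r) =
  contradiction (≡.trans (sym (↭-length q)) len) λ ()
size-lipschitz (suc k) {a} {b} {δ} {c} cs len a≤ b≤ | d@(m , c′) , ds , p , eq | inj₂ (cs′ , q , r) = begin
  size ((a , c) ∷ cs)                           ≤⟨ size-≤ (trans (prep _ q) (swap _ _ refl)) ⟩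
  m + ∣ size ((a , c) ∷ cs′) - c′ ∣             ≤⟨ ℕ.+-monoʳ-≤ m (∣-∣-≤ {δ = δ} c′ (ih a≤ b≤) (ih b≤ a≤)) ⟩
  m + (δ + ∣ size ((b , c) ∷ cs′) - c′ ∣)       ≡⟨ ℕ.+-comm m _ ⟩
  δ + ∣ size ((b , c) ∷ cs′) - c′ ∣ + m         ≡⟨ ℕ.+-assoc δ _ m ⟩
  δ + (∣ size ((b , c) ∷ cs′) - c′ ∣ + m)       ≡⟨ cong (_+_ δ) (ℕ.+-comm _ m) ⟩
  δ + (m + ∣ size ((b , c) ∷ cs′) - c′ ∣)       ≡⟨ cong (λ w → δ + (m + ∣ w - c′ ∣)) (size-cong r) ⟨
  δ + (m + ∣ size ds - c′ ∣)                    ≡⟨ cong (_+_ δ) eq ⟨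
  δ + size ((b , c) ∷ cs)                       ∎
  where
  open ℕ.≤-Reasoning
  ih : ∀ {a b} → a ≤ δ + b → b ≤ δ + a → size ((a , c) ∷ cs′) ≤ δ + size ((b , c) ∷ cs′)
  ih = size-lipschitz k cs′ (ℕ.suc-injective (≡.trans (sym (↭-length q)) len))

-- Opening the smaller component saves `m - n` at once, and the two remainders differ in value by at
-- most `m - n`.
smaller-first : ∀ {n m c} cs → n ≤ m → cost (n , c) (size ((m , c) ∷ cs)) ≤ cost (m , c) (size ((n , c) ∷ cs))
smaller-first {n} {m} {c} cs n≤m = begin
  n + ∣ size ((m , c) ∷ cs) - c ∣               ≤⟨ ℕ.+-monoʳ-≤ n (∣-∣-≤ {δ = m ∸ n} c (lip m≤ n≤) (lip n≤ m≤)) ⟩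
  n + (m ∸ n + ∣ size ((n , c) ∷ cs) - c ∣)     ≡⟨ ℕ.+-assoc n (m ∸ n) _ ⟨
  n + (m ∸ n) + ∣ size ((n , c) ∷ cs) - c ∣     ≡⟨ cong (_+ ∣ size ((n , c) ∷ cs) - c ∣) (ℕ.m+[n∸m]≡n n≤m) ⟩
  m + ∣ size ((n , c) ∷ cs) - c ∣               ∎
  where
  open ℕ.≤-Reasoning
  lip : ∀ {a b} → a ≤ m ∸ n + b → b ≤ m ∸ n + a → size ((a , c) ∷ cs) ≤ m ∸ n + size ((b , c) ∷ cs)
  lip = size-lipschitz _ cs ≡-refl
  m≤ : m ≤ m ∸ n + n
  m≤ = ℕ.≤-reflexive (sym (ℕ.m∸n+n≡m n≤m))
  n≤ : n ≤ m ∸ n + m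
  n≤ = ℕ.≤-trans n≤m (ℕ.m≤n+m m (m ∸ n))

IsLoop≥ : ℕ → ℕ × ℕ → Set
IsLoop≥ n (m , c) = c ≡ 4 × parity m ≡ 0ℙ × n ≤ m

Loops≥ : ℕ → List (ℕ × ℕ) → Set
Loops≥ n = All (IsLoop≥ n)

parity-∣-4∣ : ∀ x → parity ∣ x - 4 ∣ ≡ parity x
parity-∣-4∣ 0                         = ≡-refl
parity-∣-4∣ 1                         = ≡-refl
parity-∣-4∣ 2                         = ≡-refl
parity-∣-4∣ 3                         = ≡-refl
parity-∣-4∣ (suc (suc (suc (suc x)))) = cong parity (ℕ.∣-∣-identityʳ x)

parity-∣-2∣ : ∀ x → parity ∣ x - 2 ∣ ≡ parity x
parity-∣-2∣ 0             = ≡-refl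
parity-∣-2∣ 1             = ≡-refl
parity-∣-2∣ (suc (suc x)) = cong parity (ℕ.∣-∣-identityʳ x)

parity-cost : ∀ {n d} → IsLoop≥ n d → ∀ w → parity (cost d w) ≡ parity w
parity-cost {d = m , _} (≡-refl , even-m , _) w = begin
  parity (m + ∣ w - 4 ∣)               ≡⟨ +-homo-+ m ∣ w - 4 ∣ ⟩
  parity m ℙ.+ parity ∣ w - 4 ∣        ≡⟨ cong₂ ℙ._+_ even-m (parity-∣-4∣ w) ⟩
  parity w                             ∎
  where open ≡-Reasoning

size-[] : size [] ≡ 0
size-[] = cong ℤ.∣_∣ val-[]

loops-even : ∀ k {n} cs → List.length cs ≡ k → Loops≥ n cs → parity (size cs) ≡ 0ℙ
loops-even zero    []       len loops = cong parity size-[]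
loops-even (suc k) (c ∷ cs) len loops with d , ds , p , eq ← size-attained c cs
  with loop-d ∷ loops-ds ← All-resp-↭ p loops =
  ≡.trans (cong parity eq) (≡.trans (parity-cost loop-d (size ds))
    (loops-even k ds (ℕ.suc-injective (≡.trans (sym (↭-length p)) len)) loops-ds))

three : ℕ × ℕ
three = 1 , 2

-- Opening an even loop preserves the parity of the value; opening the 3-chain, which happens
-- exactly once, reverses it.
loops+3-odd : ∀ k {n} cs → List.length cs ≡ k → Loops≥ n cs → parity (size (three ∷ cs)) ≡ 1ℙ
loops+3-odd k cs len loops with size-attained three cs
... | d , ds , p , eq with ↭∷-∷⁻ p
...   | inj₁ (≡-refl , q) = ≡.trans (cong parity eq) (≡.trans (+-homo-+ 1 ∣ size ds - 2 ∣)
        (cong (1ℙ ℙ.+_) (≡.trans (parity-∣-2∣ (size ds)) (loops-even _ ds ≡-refl (All-resp-↭ (↭-sym q) loops)))))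
loops+3-odd zero cs len loops | d , ds , p , eq | inj₂ (cs′ , q , r) =
  contradiction (≡.trans (sym (↭-length q)) len) λ ()
loops+3-odd (suc k) cs len loops | d , ds , p , eq | inj₂ (cs′ , q , r) with loop-d ∷ loops′ ← All-resp-↭ q loops =
  ≡.trans (cong parity eq) (≡.trans (parity-cost loop-d (size ds)) (≡.trans (cong parity (size-cong r))
    (loops+3-odd k cs′ (ℕ.suc-injective (≡.trans (sym (↭-length q)) len)) loops′)))

odd⇒positive : ∀ {x} → parity x ≡ 1ℙ → 1 ≤ x
odd⇒positive {suc x} _ = s≤s z≤n

∣-4∣-odd : ∀ x → parity x ≡ 1ℙ → 1 ≤ ∣ x - 4 ∣
∣-4∣-odd x odd = odd⇒positive (≡.trans (parity-∣-4∣ x) odd)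

-- All loops here have at least 8 boxes. Both 0 and any value from 8 on are at distance at least 4
-- from 4, and the opened loop adds at least 4 to this distance.
4∣⇒0∨≥8 : ∀ k {n} cs → List.length cs ≡ k → Loops≥ (4 + n) cs → size cs ≡ 0 ⊎ 8 ≤ size cs
4∣⇒0∨≥8 k []       len loops = inj₁ size-[]
4∣⇒0∨≥8 (suc k) (c ∷ cs) len loops with size-attained c cs
... | (m , _) , ds , p , eq with All-resp-↭ p loops
...   | (≡-refl , _ , n≤m) ∷ loops-ds = inj₂ (subst (8 ≤_) (sym eq)
        (ℕ.+-mono-≤ {4} {m} {4} (ℕ.≤-trans (ℕ.m≤m+n 4 _) n≤m)
          (∣-4∣≥4 (4∣⇒0∨≥8 k ds (ℕ.suc-injective (≡.trans (sym (↭-length p)) len)) loops-ds))))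
  where
  ∣-4∣≥4 : ∀ {w} → w ≡ 0 ⊎ 8 ≤ w → 4 ≤ ∣ w - 4 ∣
  ∣-4∣≥4 (inj₁ ≡-refl) = ℕ.≤-refl
  ∣-4∣≥4 {suc (suc (suc (suc w)))} (inj₂ (s≤s (s≤s (s≤s (s≤s 4≤w))))) = subst (4 ≤_) (sym (ℕ.∣-∣-identityʳ w)) 4≤w

module _ {n cs} (even-n : parity n ≡ 0ℙ) (loops : Loops≥ n cs) where

  private
    k = size cs
    w = size (three ∷ cs)
    h = size ((n , 4) ∷ cs)
    g = size (three ∷ (n , 4) ∷ cs)

    k-even : parity k ≡ 0ℙ
    k-even = loops-even _ cs ≡-refl loops

    w-odd : parity w ≡ 1ℙ
    w-odd = loops+3-odd _ cs ≡-refl loops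

    w≤ : w ≤ 1 + ∣ k - 2 ∣
    w≤ = size-≤ refl

    openL openChain : ℕ
    openL     = cost (n , 4) w
    openChain = cost three h

  h≡ : h ≡ n + ∣ k - 4 ∣
  h≡ = ℕ.≤-antisym (size-≤ refl) lower
    where
    lower : n + ∣ k - 4 ∣ ≤ h
    lower with d , ds , p , eq ← size-attained (n , 4) cs with ↭∷-∷⁻ p
    ... | inj₁ (≡-refl , q) = ℕ.≤-reflexive (sym (≡.trans eq (cong (cost (n , 4)) (size-cong q))))
    ... | inj₂ (cs′ , q , r) with All-resp-↭ q loops
    ...   | (≡-refl , _ , n≤m) ∷ _ = subst₂ _≤_ (cong (cost (n , 4)) (size-cong (↭-sym q)))
            (sym (≡.trans eq (cong (cost d) (size-cong r)))) (smaller-first cs′ n≤m)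

  -- By `smaller-first` no loop of `cs` is cheaper to open than `L`, so only `L` and the 3-chain
  -- compete.
  g-attained : g ≡ openChain ⊎ openL ≤ g
  g-attained with d , ds , p , eq ← size-attained three ((n , 4) ∷ cs) with ↭∷-∷⁻ p
  ... | inj₁ (≡-refl , q) = inj₁ (≡.trans eq (cong (cost three) (size-cong q)))
  ... | inj₂ (_ , q , r) with ↭∷-∷⁻ q
  ...   | inj₁ (≡-refl , s) = inj₂ (ℕ.≤-reflexive
          (sym (≡.trans eq (cong (cost (n , 4)) (size-cong (trans r (prep three s)))))))
  ...   | inj₂ (cs′ , s , t) with All-resp-↭ s loops
  ...     | (≡-refl , _ , n≤m) ∷ _ = inj₂ (subst₂ _≤_
            (cong (cost (n , 4)) (size-cong (trans (swap _ _ refl) (prep three (↭-sym s)))))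
            (sym (≡.trans eq (cong (cost d) (size-cong (trans r (trans (prep three t) (swap _ _ refl)))))))
            (smaller-first (three ∷ cs′) n≤m))

  openChain-optimal : openChain ≤ openL → openChain ≡ g
  openChain-optimal chain≤ with g-attained
  ... | inj₁ eq  = sym eq
  ... | inj₂ L≤g = ℕ.≤-antisym (ℕ.≤-trans chain≤ L≤g) (size-≤ refl)

  openL-optimal : openL ≤ openChain → openL ≡ g
  openL-optimal L≤ = ℕ.≤-antisym upper (size-≤ (swap _ _ refl))
    where
    upper : openL ≤ g
    upper with g-attained
    ... | inj₁ eq  = subst (openL ≤_) (sym eq) L≤
    ... | inj₂ L≤g = L≤g

  -- The 3-chain then costs just 1, and `openL` is not 0 because the odd `w` differs from 4.
  h≡2⇒openChain : h ≡ 2 → openChain ≡ g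
  h≡2⇒openChain h≡2 = openChain-optimal (subst (λ h → cost three h ≤ openL) (sym h≡2)
    (ℕ.≤-trans (∣-4∣-odd w w-odd) (ℕ.m≤n+m _ n)))

  -- Here `h` is 4 and the 3-chain costs 3, while `openL` is at least `2 + 1` as `w` is odd.
  n≡2∧k≡2⇒openChain : n ≡ 2 → k ≡ 2 → openChain ≡ g
  n≡2∧k≡2⇒openChain ≡-refl k≡2 = openChain-optimal (begin
    cost three h               ≡⟨ cong (cost three) (≡.trans h≡ (cong (cost (2 , 4)) k≡2)) ⟩
    3                          ≤⟨ s≤s (s≤s (∣-4∣-odd w w-odd)) ⟩
    openL                      ∎)
    where open ℕ.≤-Reasoning

  -- If the 3-chain is the best opening, the even `k ≢ 2` is at distance at least 2 from 2. If a
  -- loop is, it contributes at least 2 and the odd value of the rest at least 1.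
  w≥3 : 2 ≤ n → k ≢ 2 → 3 ≤ w
  w≥3 2≤n k≢2 with d , ds , p , eq ← size-attained three cs with ↭∷-∷⁻ p
  ... | inj₁ (≡-refl , q) = subst (3 ≤_) (sym (≡.trans eq (cong (cost three) (size-cong q)))) (s≤s (2≤ k k-even k≢2))
    where
    2≤ : ∀ k → parity k ≡ 0ℙ → k ≢ 2 → 2 ≤ ∣ k - 2 ∣
    2≤ 0                         _  _   = ℕ.≤-refl
    2≤ 1                         () _
    2≤ 2                         _  k≢2 = contradiction ≡-refl k≢2
    2≤ 3                         () _
    2≤ (suc (suc (suc (suc k)))) _  _   = s≤s (s≤s z≤n)
  ... | inj₂ (cs′ , q , r) with All-resp-↭ q loops
  ...   | (≡-refl , _ , n≤m) ∷ loops′ = subst (3 ≤_) (sym (≡.trans eq (cong (cost d) (size-cong r))))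
          (ℕ.+-mono-≤ {2} (ℕ.≤-trans 2≤n n≤m) (∣-4∣-odd (size (three ∷ cs′)) (loops+3-odd _ cs′ ≡-refl loops′)))

  -- By `h≡` both costs are functions of `n`, `k` and `w`. The cases are `k = 0`, `k ≥ 8`, and `k`
  -- equal to 2, 4 or 6, where only `n = 0` and `n = 2` are possible.
  openL≤openChain : h ≢ 2 → ¬ (n ≡ 2 × k ≡ 2) → openL ≤ openChain
  openL≤openChain h≢2 ¬2,2 = subst (λ h → openL ≤ cost three h) (sym h≡)
    (compare n k w even-n k-even (odd⇒positive w-odd) w≤ (h≢2 ∘ ≡.trans h≡) ¬2,2 w≥3
      λ { i ≡-refl → 4∣⇒0∨≥8 _ cs ≡-refl loops })
    where
    ∣-4∣-≤ : ∀ j w → 1 ≤ w → w ≤ 7 + j → ∣ w - 4 ∣ ≤ 3 + j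
    ∣-4∣-≤ j 1 _ _ = ℕ.m≤m+n 3 j
    ∣-4∣-≤ j 2 _ _ = s≤s (s≤s z≤n)
    ∣-4∣-≤ j 3 _ _ = s≤s z≤n
    ∣-4∣-≤ j (suc (suc (suc (suc w)))) _ (s≤s (s≤s (s≤s (s≤s w≤)))) = subst (_≤ 3 + j) (sym (ℕ.∣-∣-identityʳ w)) w≤

    ∣-4∣-≤₃ : ∀ w → 1 ≤ w → w ≤ 3 → ∣ w - 4 ∣ ≤ 3
    ∣-4∣-≤₃ w 1≤w w≤3 = ∣-4∣-≤ 0 w 1≤w (ℕ.≤-trans w≤3 (ℕ.m≤m+n 3 4))

    ∣-4∣-≤₁ : ∀ w → 3 ≤ w → w ≤ 5 → ∣ w - 4 ∣ ≤ 1
    ∣-4∣-≤₁ 3 _ _ = ℕ.≤-refl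
    ∣-4∣-≤₁ 4 _ _ = z≤n
    ∣-4∣-≤₁ 5 _ _ = ℕ.≤-refl
    ∣-4∣-≤₁ 1 (s≤s ()) _
    ∣-4∣-≤₁ 2 (s≤s (s≤s ())) _
    ∣-4∣-≤₁ (suc (suc (suc (suc (suc (suc w)))))) _ (s≤s (s≤s (s≤s (s≤s (s≤s ())))))

    dist : ∀ n j → 1 + ∣ n + (2 + j) - 2 ∣ ≡ n + (1 + j)
    dist n j = begin
      1 + ∣ n + (2 + j) - 2 ∣     ≡⟨ cong (λ x → 1 + ∣ x - 2 ∣) (≡.trans (ℕ.+-suc n (suc j)) (cong suc (ℕ.+-suc n j))) ⟩
      1 + ∣ n + j - 0 ∣           ≡⟨ cong suc (ℕ.∣-∣-identityʳ (n + j)) ⟩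
      1 + (n + j)                 ≡⟨ ℕ.+-suc n j ⟨
      n + (1 + j)                 ∎
      where open ≡-Reasoning

    compare : ∀ n k w → parity n ≡ 0ℙ → parity k ≡ 0ℙ → 1 ≤ w → w ≤ 1 + ∣ k - 2 ∣ → n + ∣ k - 4 ∣ ≢ 2 →
              ¬ (n ≡ 2 × k ≡ 2) → (2 ≤ n → k ≢ 2 → 3 ≤ w) → (∀ i → n ≡ 4 + i → k ≡ 0 ⊎ 8 ≤ k) →
              n + ∣ w - 4 ∣ ≤ 1 + ∣ n + ∣ k - 4 ∣ - 2 ∣
    -- For `k = 0` and `k = 8 + j` the 3-chain costs `n + 3` and `n + 3 + j`, while the bounds on
    -- `w` give `∣ w - 4 ∣` at most 3 and `3 + j`.
    compare n 0 w _ _ 1≤w w≤3 _ _ _ _ = subst (n + ∣ w - 4 ∣ ≤_) (sym (dist n 2)) (ℕ.+-monoʳ-≤ n (∣-4∣-≤₃ w 1≤w w≤3))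
    compare n (suc (suc (suc (suc (suc (suc (suc (suc j)))))))) w _ _ 1≤w w≤ _ _ _ _ =
      subst (n + ∣ w - 4 ∣ ≤_) (sym (dist n (2 + j))) (ℕ.+-monoʳ-≤ n (∣-4∣-≤ j w 1≤w w≤))
    compare n 1 w _ ()
    compare n 3 w _ ()
    compare n 5 w _ ()
    compare n 7 w _ ()
    compare 1 _ w ()
    compare 3 _ w ()
    -- Of these six pairs the hypotheses leave only (0, 4) and (2, 6); in the latter `w` lies
    -- between 3 and 5.
    compare 0 2 w _ _ _ _ h≢2 = contradiction ≡-refl h≢2
    compare 0 4 w _ _ 1≤w w≤3 _ _ _ _ = ∣-4∣-≤₃ w 1≤w w≤3
    compare 0 6 w _ _ _ _ h≢2 = contradiction ≡-refl h≢2
    compare 2 2 w _ _ _ _ _ ¬2,2 = contradiction (≡-refl , ≡-refl) ¬2,2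
    compare 2 4 w _ _ _ _ h≢2 = contradiction ≡-refl h≢2
    compare 2 6 w _ _ _ w≤5 _ _ 3≤w _ = s≤s (s≤s (∣-4∣-≤₁ w (3≤w ℕ.≤-refl λ ()) w≤5))
    -- If `L` has at least 8 boxes, so has every loop of K, and `k` cannot be 2, 4 or 6.
    compare (suc (suc (suc (suc n)))) 2 w _ _ _ _ _ _ _ big =
      [ (λ ()) , (λ 8≤2 → contradiction 8≤2 (from-no (8 ℕ.≤? 2))) ]′ (big n ≡-refl)
    compare (suc (suc (suc (suc n)))) 4 w _ _ _ _ _ _ _ big =
      [ (λ ()) , (λ 8≤4 → contradiction 8≤4 (from-no (8 ℕ.≤? 4))) ]′ (big n ≡-refl)
    compare (suc (suc (suc (suc n)))) 6 w _ _ _ _ _ _ _ big =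
      [ (λ ()) , (λ 8≤6 → contradiction 8≤6 (from-no (8 ℕ.≤? 6))) ]′ (big n ≡-refl)

-- The values of G, H, K and of the two openings

even-type : ∀ {n} (L : EvenLoop) → n ≤ length L → IsLoop≥ (n ∸ 4) (type L)
even-type {n} L n≤ = ≡-refl , parity-even (subst (2 ∣_) (sym (ℕ.m+[n∸m]≡n (4≤ L))) (even L)) , ℕ.∸-monoˡ-≤ 4 n≤
  where
  parity-even : ∀ {m} → 2 ∣ 4 + m → parity m ≡ 0ℙ
  parity-even {m} (divides q eq) = ≡.trans (cong parity eq) (≡.trans (*-homo-* q 2) (ℙ.*-zeroʳ (parity q)))

module _ (Ks : List EvenLoop) (L : EvenLoop) where

  private
    K = loops Ks
    H = K ⊕ evenLoop L
    G = H ⊕ chain 3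

    ks : List (ℕ × ℕ)
    ks = List.map type Ks

    ℓ : ℕ × ℕ
    ℓ = type L

    L-component : Component (hyper (lines (evenLoop L))) ℓ
    L-component = loop-component (length L) (4≤ L)

    K-endgame : Endgame ks (hyper (lines K))
    K-endgame = loops-endgame Ks

    H-endgame : Endgame (ks ++ ℓ ∷ []) (hyper (lines H))
    H-endgame = endgame-⊕ K (evenLoop L) K-endgame (endgame-single L-component)

    three-endgame : Endgame (three ∷ []) (hyper (lines (chain 3)))
    three-endgame = endgame-single chain-component

    chainPart LPart : Pos
    chainPart = shiftBoxes (#boxes H) (hyper (lines (chain 3)))
    LPart     = shiftBoxes (#boxes K) (hyper (lines (evenLoop L)))

    hyper-G : hyper (lines G) ≡ hyper (lines H) ++ chainPart
    hyper-G = hyper-⊎ₚ (lines H) (lines (chain 3))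

    hyper-H : hyper (lines H) ≡ hyper (lines K) ++ LPart
    hyper-H = hyper-⊎ₚ (lines K) (lines (evenLoop L))

    H##chain : hyper (lines H) ## chainPart
    H##chain = hyper-##-shift (lines H) _

    on-K : ∀ {x} → x On hyper (lines K) → x On hyper (lines H)
    on-K x∈ = subst (_ On_) (sym hyper-H) (Any.++⁺ˡ x∈)

    on-L : ∀ {x} → x On LPart → x On hyper (lines H)
    on-L x∈ = subst (_ On_) (sym hyper-H) (Any.++⁺ʳ (hyper (lines K)) x∈)

  v-K : v K ≡ + size ks
  v-K = ≡.trans (value≡val K-endgame) (val≡+size ks)

  v-H : v H ≡ + size (ℓ ∷ ks)
  v-H = ≡.trans (value≡val H-endgame) (≡.trans (val≡+size (ks ++ ℓ ∷ [])) (cong +_ (size-cong (++-comm ks (ℓ ∷ [])))))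

  v-G : v G ≡ + size (three ∷ ℓ ∷ ks)
  v-G = ≡.trans (value≡val (endgame-⊕ H (chain 3) H-endgame three-endgame))
    (≡.trans (val≡+size ((ks ++ ℓ ∷ []) ++ three ∷ []))
      (cong +_ (size-cong (trans (++-comm (ks ++ ℓ ∷ []) (three ∷ [])) (prep three (++-comm ks (ℓ ∷ [])))))))

  v-chain : ∀ m → v[ G ⨾ inʳ H (chain 3) m ] ≡ + cost three (size (ℓ ∷ ks))
  v-chain m = ≡.trans
    (moveValue≡opening (lines G) (inʳ H (chain 3) m) (trans (↭-reflexive hyper-G) (++-comm (hyper (lines H)) chainPart))
      (lookup-inʳ H (chain 3) m) (component-shift (#boxes H) chain-component) (λ x∈C x∈H → H##chain x∈H x∈C) H-endgame)
    (≡.trans (opening-val three (ks ++ ℓ ∷ [])) (cong (λ w → + cost three w) (size-cong (++-comm ks (ℓ ∷ [])))))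

  -- `L` stands between K and the 3-chain in `G`, so the parts are rearranged to read `L` beside the
  -- endgame K + 3.
  v-L : ∀ m → v[ G ⨾ inˡ H (chain 3) (inʳ K (evenLoop L) m) ] ≡ + cost ℓ (size (three ∷ ks))
  v-L m = ≡.trans
    (moveValue≡opening (lines G) (inˡ H (chain 3) (inʳ K (evenLoop L) m))
      (trans (↭-reflexive (≡.trans hyper-G (cong (List._++ chainPart) hyper-H))) L-first)
      (subst (_∈ LPart) (sym (lookup-inˡ H (chain 3) (inʳ K (evenLoop L) m))) (lookup-inʳ K (evenLoop L) m))
      (component-shift (#boxes K) L-component)
      (λ x∈L x∈KC → [ (λ x∈K → hyper-##-shift (lines K) _ x∈K x∈L) , H##chain (on-L x∈L) ]′ (Any.++⁻ (hyper (lines K)) x∈KC))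
      (endgame-++ K-endgame (endgame-shift (#boxes H) three-endgame) (H##chain ∘ on-K)))
    (≡.trans (opening-val ℓ (ks ++ three ∷ [])) (cong (λ w → + cost ℓ w) (size-cong (++-comm ks (three ∷ [])))))
    where
    L-first : (hyper (lines K) ++ LPart) ++ chainPart ↭ LPart ++ hyper (lines K) ++ chainPart
    L-first = trans (++⁺ʳ chainPart (++-comm (hyper (lines K)) LPart)) (↭-reflexive (++-assoc LPart (hyper (lines K)) chainPart))

theorem23 :
    (Ks : List EvenLoop) (L : EvenLoop) → All (λ M → length L ≤ length M) Ks →
    let K = loops Ks
        H = K ⊕ evenLoop L
        G = H ⊕ chain 3
        OpenChainOptimal = (m : Move (chain 3)) → Optimal G (inʳ H (chain 3) m)
        OpenLOptimal = (m : Move (evenLoop L)) → Optimal G (inˡ H (chain 3) (inʳ K (evenLoop L) m))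
    in (v H ≡ + 2 → OpenChainOptimal)
     × (v H ≢ + 2 → length L ≡ 6 → v K ≡ + 2 → OpenChainOptimal)
     × (v H ≢ + 2 → ¬ (length L ≡ 6 × v K ≡ + 2) → OpenLOptimal)
theorem23 Ks L L≤Ks =
    (λ vH≡2 → chain-optimal (h≡2⇒openChain even-L loops-K (ℤ.+-injective (≡.trans (sym (v-H Ks L)) vH≡2))))
  , (λ _ L≡6 vK≡2 → chain-optimal (n≡2∧k≡2⇒openChain even-L loops-K (cong (_∸ 4) L≡6)
      (ℤ.+-injective (≡.trans (sym (v-K Ks L)) vK≡2))))
  , (λ vH≢2 ¬6,2 m → ≡.trans (v-L Ks L m) (≡.trans
      (cong +_ (openL-optimal even-L loops-K (openL≤openChain even-L loops-K
        (λ h≡2 → vH≢2 (≡.trans (v-H Ks L) (cong +_ h≡2)))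
        (λ (n≡2 , k≡2) → ¬6,2 (≡.trans (sym (ℕ.m+[n∸m]≡n (4≤ L))) (cong (_+_ 4) n≡2) , ≡.trans (v-K Ks L) (cong +_ k≡2))))))
      (sym (v-G Ks L))))
  where
  n = length L ∸ 4
  ks = List.map type Ks

  even-L : parity n ≡ 0ℙ
  even-L = proj₁ (proj₂ (even-type L ℕ.≤-refl))

  loops-K : Loops≥ n ks
  loops-K = All.map⁺ (All.map (λ {M} → even-type M) L≤Ks)

  chain-optimal : cost three (size ((n , 4) ∷ ks)) ≡ size (three ∷ (n , 4) ∷ ks) → ∀ m →
                  Optimal (loops Ks ⊕ evenLoop L ⊕ chain 3) (inʳ (loops Ks ⊕ evenLoop L) (chain 3) m)
  chain-optimal eq m = ≡.trans (v-chain Ks L m) (≡.trans (cong +_ eq) (sym (v-G Ks L)))
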